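{- For the uniform distribution on unary automata with $n$ states, the average time complexity of Moore's state minimization algorithm is $\Theta(n\log n)$ as $n\to\infty$. That is, if $\mathcal{U}_n$ denotes the set of accessible, deterministic and complete automata with $n$ states over a one-letter alphabet and $\mathcal{W}(\mathcal{A})$ denotes the running time of Moore's algorithm on input $\mathcal{A}$, then $$\frac{1}{|\mathcal{U}_n|}\sum_{\mathcal{A}\in\mathcal{U}_n}\mathcal{W}(\mathcal{A})=\Theta(n\log n).$$
   Context: A (finite, complete, deterministic) automaton is a quintuple $\mathcal{A}=(A,Q,\cdot,q_0,F)$ with $Q$ a finite set of states, $A$ a finite alphabet, a total transition function $\cdot:Q\times A\to Q$, an initial state $q_0\in Q$, and a set of final states $F\subseteq Q$ (any subset, possibly empty or equal to $Q$). The automaton is accessible if every state is of the form $q_0\cdot u$ for some word $u\in A^*$, where $p\cdot\varepsilon=p$ and $p\cdot(uv)=(p\cdot u)\cdot v$. A unary automaton is an accessible, deterministic and complete automaton over a one-letter alphabet $A=\{a\}$. Labelling its states in depth-first order from the initial state, a unary automaton with $n$ states has $Q=\{1,\dots,n\}$, initial state $1$, $q\cdot a=q+1$ for $1\le q\le n-1$, and is determined by the state $n\cdot a\in\{1,\dots,n\}$ and the set $F\subseteq\{1,\dots,n\}$; hence there are $n2^n$ unary automata with $n$ states, and the uniform distribution is over these. For a Boolean condition, $[\![\mathrm{Cond}]\!]$ is $1$ if the condition holds and $0$ otherwise. Moore's algorithm on input $\mathcal{A}=(A,\{1,\dots,n\},\cdot,q_0,F)$ with $A=\{a_1,\dots,a_k\}$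 (here $k=1$): (1) If $F=\emptyset$ or $F=\{1,\dots,n\}$, return the corresponding one-state automaton (with no final state, respectively with its single state final). (2) Otherwise set $\pi'[p]=[\![p\in F]\!]$ for every state $p$, and let $\pi$ be undefined. (3) Main loop: while $\pi\ne\pi'$ as partitions of the set of states, set $\pi=\pi'$ and compute the new partition $\pi'$ such that $\pi'[p]=\pi'[q]$ if and only if $\pi[p]=\pi[q]$ and $\pi[p\cdot a]=\pi[q\cdot a]$ for all $a\in A$. This computation is done by associating to each state $p$ the $(k+1)$-tuple $s[p]=(\pi[p],\pi[p\cdot a_1],\dots,\pi[p\cdot a_k])$, sorting the states by their tuples with a lexicographic (radix/bucket) sort, and giving successive integer labels to the groups of states having equal tuples. (4) Return the quotient of $\mathcal{A}$ by the partition $\pi$. Running time is counted in elementary operations on a unit-cost RAM. -}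

module Defs where

open import Data.Bool using (Bool; true; false; not; _∧_; if_then_else_)
open import Data.Fin as Fin using (Fin; zero; suc; toℕ; fromℕ<)
open import Data.Fin.Properties using (fromℕ<-toℕ; toℕ-fromℕ<; toℕ<n)
open import Data.Fin.Subset using (Subset; inside; outside)
open import Data.Integer using (+_)
open import Data.List using (List; []; _∷_; [_]; _++_; map; length; allFin; downFrom; foldr; cartesianProductWith)
open import Data.Maybe using (Maybe; just; nothing)
open import Data.Nat as ℕ using (ℕ; zero; suc; _⊔_; _≡ᵇ_)
open import Data.Nat.Logarithm using (⌊log₂_⌋)
open import Data.Nat.ListAction using (sum)
open import Data.Nat.Properties using (<-trans; n<1+n)
open import Data.Product using (∃-syntax; _×_; _,_; proj₁; proj₂)
open import Data.Rational.Unnormalised using (ℚᵘ; 0ℚᵘ; _/_; _*_; _≤_; _<_)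
open import Data.Vec as Vec using (Vec; []; _∷_; lookup)
open import Relation.Binary.Definitions using (DecidableEquality)
open import Relation.Binary.PropositionalEquality using (_≡_; refl; sym; trans; cong)
open import Relation.Nullary using (yes; no; does; contradiction)

private variable
  k n : ℕ
  I S X Y : Set

record Automaton (k n : ℕ) : Set where
  field
    δ  : Fin n → Fin k → Fin n
    q₀ : Fin n
    F  : Subset n

open Automaton public

Word : ℕ → Set
Word k = List (Fin k)

δ* : Automaton k n → Fin n → Word k → Fin n
δ* A p []      = p
δ* A p (a ∷ u) = δ* A (δ A p a) u

Accessible : Automaton k n → Set
Accessible A = ∀ q → ∃[ u ] δ* A (q₀ A) u ≡ q

-- States are numbered from 0 in depth-first order, so that the only free
-- transition is the one leaving the last state.
next : Fin n → Fin n → Fin n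
next {n} t q with suc (toℕ q) ℕ.<? n
... | yes q+1<n = fromℕ< q+1<n
... | no  _     = t

unary : Fin (suc n) → Subset (suc n) → Automaton 1 (suc n)
unary t F = record { δ = λ q _ → next t q ; q₀ = zero ; F = F }

subsets : ∀ n → List (Subset n)
subsets zero    = [ [] ]
subsets (suc n) = map (inside ∷_) (subsets n) ++ map (outside ∷_) (subsets n)

unaryAutomata : ∀ n → List (Automaton 1 n)
unaryAutomata zero    = []
unaryAutomata (suc n) = cartesianProductWith unary (allFin (suc n)) (subsets (suc n))

-- A computation carries its result and the number of elementary operations
-- it performs.  Array accesses, comparisons, arithmetic and Boolean
-- operations, and list constructions each count 1.

infix 3 _after_
record Time (X : Set) : Set where
  constructor _after_
  field
    value : X
    cost  : ℕ

open Time public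

infixl 1 _>>=_

return : X → Time X
return x = x after 0

_>>=_ : Time X → (X → Time Y) → Time Y
m >>= f = value (f (value m)) after cost m ℕ.+ cost (f (value m))

op : X → Time X
op x = x after 1

-- Random-access memory.  Arrays are used single-threadedly, so that `write`
-- can be executed in place.
Array : Set → Set → Set
Array I X = I → X

-- Allocation of an array of n cells, all of which are filled with x.
new : ℕ → X → Time (Array I X)
new n x = (λ _ → x) after n

read : Array I X → I → Time X
read a i = op (a i)

write : DecidableEquality I → Array I X → I → X → Time (Array I X)
write _≟_ a i x = op (λ j → if does (i ≟ j) then x else a j)

-- One operation per loop iteration, and one for detecting the end.
forEach : List I → S → (S → I → Time S) → Time S
forEach []       s body = op s
forEach (i ∷ is) s body = do
  i′ ← op i
  s′ ← body s i′
  forEach is s′ body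

tuple : (Fin k → Time X) → Time (Vec X k)
tuple {k = zero}  f = op []
tuple {k = suc k} f = do
  x  ← f zero
  xs ← tuple (λ i → f (suc i))
  op (x ∷ xs)

sameTuple : Vec ℕ k → Vec ℕ k → Time Bool
sameTuple []       []       = op true
sameTuple (x ∷ xs) (y ∷ ys) = do
  e ← op (x ≡ᵇ y)
  b ← sameTuple xs ys
  op (e ∧ b)

-- While test body s r: the loop started in state s terminates, and r gives
-- its final state and its total cost.
data While (test : S → Time Bool) (body : S → Time S) : S → Time S → Set where
  exit : ∀ {s} → value (test s) ≡ false →
         While test body s (s after cost (test s))
  iterate : ∀ {s r} → value (test s) ≡ true →
         While test body (value (body s)) r →
         While test body s (value r after cost (test s) ℕ.+ (cost (body s) ℕ.+ cost r))

-- A partition of the states is stored as an array of class labels.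
Labels : ℕ → Set
Labels n = Array (Fin n) ℕ

-- The resulting automaton, as written in memory: only the states below
-- `size` are meaningful.
record Table (k : ℕ) : Set where
  field
    size  : ℕ
    start : ℕ
    move  : Array ℕ (Vec ℕ k)
    final : Array ℕ Bool

module _ {k n : ℕ} (A : Automaton k n) where

  states : List (Fin n)
  states = allFin n

  step : Fin n → Fin k → Time (Fin n)
  step p a = op (δ A p a)

  isFinal : Fin n → Time Bool
  isFinal p = op (lookup (F A) p)

  -- (Is F empty? , Is F the set of all states?)
  finality : Time (Bool × Bool)
  finality = forEach states (true , true) λ (none , all) p → do
    x     ← isFinal p
    none′ ← op (none ∧ not x)
    all′  ← op (all ∧ x)
    return (none′ , all′)

  singleton : Bool → Time (Table k)
  singleton b = do
    row  ← tuple (λ _ → op 0)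
    move ← new 1 row
    fin  ← new 1 b
    op (record { size = 1 ; start = 0 ; move = move ; final = fin })

  initial : Time (Labels n)
  initial = do
    π ← new n 0
    forEach states π λ π p → do
      x ← isFinal p
      l ← op (if x then 1 else 0)
      write Fin._≟_ π p l

  Signatures : Set
  Signatures = Array (Fin n) (Vec ℕ (suc k))

  signature : Labels n → Fin n → Time (Vec ℕ (suc k))
  signature π p = do
    l  ← read π p
    ls ← tuple λ a → do
      q ← step p a
      read π q
    op (l ∷ ls)

  signatures : Labels n → Time Signatures
  signatures π = do
    s ← new n (Vec.replicate (suc k) 0)
    forEach states s λ s p → do
      t ← signature π p
      write Fin._≟_ s p t

  -- Stable bucket sort of the states ps by the component j of their tuples.
  -- Buckets are filled at the front, hence hold their states in reverse
  -- order; emptying them from the last to the first, each time at the front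
  -- of the output, restores the order.
  bucketSort : Signatures → Fin (suc k) → List (Fin n) → Time (List (Fin n))
  bucketSort s j ps = do
    empty   ← new n []
    buckets ← forEach ps empty λ buckets p → do
      t  ← read s p
      l  ← op (lookup t j)
      qs ← read buckets l
      qs′ ← op (p ∷ qs)
      write ℕ._≟_ buckets l qs′
    forEach (downFrom n) [] λ out l → do
      qs ← read buckets l
      forEach qs out λ out q → op (q ∷ out)

  -- Lexicographic sort: one stable pass per component, the last one first.
  radixSort : Signatures → Time (List (Fin n))
  radixSort s = foldr (λ j sorted → sorted >>= bucketSort s j)
                      (forEach states [] (λ ps p → op (p ∷ ps)))
                      (allFin (suc k))

  -- t and l are the tuple and the label of the previous state.
  number : Signatures → Vec ℕ (suc k) → ℕ → Labels n → List (Fin n) → Time (Labels n)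
  number s t l π []       = op π
  number s t l π (p ∷ ps) = do
    t′ ← read s p
    e  ← sameTuple t t′
    l′ ← op (if e then l else suc l)
    π′ ← write Fin._≟_ π p l′
    number s t′ l′ π′ ps

  numbering : Signatures → List (Fin n) → Time (Labels n)
  numbering s []       = new n 0
  numbering s (p ∷ ps) = do
    π ← new n 0
    t ← read s p
    number s t 0 π (p ∷ ps)

  refine : Labels n → Time (Labels n)
  refine π = do
    s  ← signatures π
    ps ← radixSort s
    numbering s ps

  -- The loop state is (π , π′), where π is initially undefined.
  LoopState : Set
  LoopState = Maybe (Labels n) × Labels n

  -- Labels are compared one by one.  This compares the partitions: the
  -- labels in use are always 0, …, c - 1 for some c, and classes are
  -- renumbered in increasing order of their old label first, so that an
  -- unchanged partition keeps its labels.
  different : LoopState → Time Bool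
  different (nothing , π′) = op true
  different (just π  , π′) = do
    same ← forEach states true λ same p → do
      l  ← read π p
      l′ ← read π′ p
      e  ← op (l ≡ᵇ l′)
      op (same ∧ e)
    op (not same)

  round : LoopState → Time LoopState
  round (_ , π′) = do
    π  ← op π′
    π″ ← refine π
    return (just π , π″)

  quotient : Labels n → Time (Table k)
  quotient π = do
    move  ← new n (Vec.replicate k 0)
    final ← new n false
    start ← read π (q₀ A)
    forEach states (record { size = 0 ; start = start ; move = move ; final = final }) λ T p → do
      l      ← read π p
      row    ← tuple λ a → do
        q ← step p a
        read π q
      x      ← isFinal p
      size′  ← op (Table.size T ⊔ suc l)
      move′  ← write ℕ._≟_ (Table.move T) l row
      final′ ← write ℕ._≟_ (Table.final T) l x
      return (record T { size = size′ ; move = move′ ; final = final′ })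

  -- Moore r: the algorithm terminates on A, and r gives its output and its
  -- running time.  When the loop exits, π and π′ are equal.
  data Moore : Time (Table k) → Set where
    F-empty  : proj₁ (value finality) ≡ true →
               Moore (finality >>= λ _ → singleton false)
    F-full   : proj₁ (value finality) ≡ false → proj₂ (value finality) ≡ true →
               Moore (finality >>= λ _ → singleton true)
    F-proper : ∀ {r} → proj₁ (value finality) ≡ false → proj₂ (value finality) ≡ false →
               While different round (nothing , value initial) r →
               Moore (finality >>= λ _ → initial >>= λ _ → r >>= λ (_ , π) → quotient π)

  RunningTime : ℕ → Set
  RunningTime t = ∃[ r ] Moore r × cost r ≡ t

average : List ℕ → ℚᵘ
average []          = 0ℚᵘ
average xs@(_ ∷ _) = + sum xs / length xs

infix 4 _=Θ_
_=Θ_ : (ℕ → ℚᵘ) → (ℕ → ℚᵘ) → Set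
f =Θ g = ∃[ c ] ∃[ C ] ∃[ N ]
  0ℚᵘ < c × 0ℚᵘ < C × (∀ n → N ℕ.≤ n → c * g n ≤ f n × f n ≤ C * g n)

-- The base and the rounding of the logarithm are irrelevant under Θ.
nlogn : ℕ → ℚᵘ
nlogn n = + (n ℕ.* ⌊log₂ n ⌋) / 1

private
  next-fromℕ< : ∀ {i} (t : Fin n) (i<n : i ℕ.< n) (i+1<n : suc i ℕ.< n) →
                next t (fromℕ< i<n) ≡ fromℕ< i+1<n
  next-fromℕ< {n} {i} t i<n i+1<n with suc (toℕ (fromℕ< i<n)) ℕ.<? n
  ... | yes p rewrite toℕ-fromℕ< i<n = refl
  ... | no ¬p rewrite toℕ-fromℕ< i<n = contradiction i+1<n ¬p

  δ*-snoc : ∀ (A : Automaton k n) p u a → δ* A p (u ++ [ a ]) ≡ δ A (δ* A p u) a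
  δ*-snoc A p []      a = refl
  δ*-snoc A p (b ∷ u) a = δ*-snoc A (δ A p b) u a

  reach : ∀ (t : Fin (suc n)) F i (i<n : i ℕ.< suc n) →
          ∃[ u ] δ* (unary t F) zero u ≡ fromℕ< i<n
  reach t F zero    i<n = [] , refl
  reach t F (suc i) i<n with reach t F i (<-trans (n<1+n i) i<n)
  ... | u , eq = u ++ [ zero ] , trans (δ*-snoc (unary t F) zero u zero)
        (trans (cong (next t) eq) (next-fromℕ< t (<-trans (n<1+n i) i<n) i<n))

unary-accessible : ∀ (t : Fin (suc n)) F → Accessible (unary t F)
unary-accessible t F q with reach t F (toℕ q) (toℕ<n q)
... | u , eq = u , trans eq (fromℕ<-toℕ q _)

private
  While-unique : ∀ {test : S → Time Bool} {body s r r′} →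
                 While test body s r → While test body s r′ → r ≡ r′
  While-unique (exit _)      (exit _)       = refl
  While-unique (exit p)      (iterate q _)  with () ← trans (sym p) q
  While-unique (iterate p _) (exit q)       with () ← trans (sym p) q
  While-unique (iterate _ w) (iterate _ w′) with refl ← While-unique w w′ = refl

  Moore-unique : ∀ {A : Automaton k n} {r r′} → Moore A r → Moore A r′ → r ≡ r′
  Moore-unique (F-empty _)      (F-empty _)       = refl
  Moore-unique (F-empty p)      (F-full q _)      with () ← trans (sym p) q
  Moore-unique (F-empty p)      (F-proper q _ _)  with () ← trans (sym p) q
  Moore-unique (F-full p _)     (F-empty q)       with () ← trans (sym p) q
  Moore-unique (F-full _ _)     (F-full _ _)      = refl
  Moore-unique (F-full _ p)     (F-proper _ q _)  with () ← trans (sym p) q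
  Moore-unique (F-proper p _ _) (F-empty q)       with () ← trans (sym p) q
  Moore-unique (F-proper _ p _) (F-full _ q)      with () ← trans (sym p) q
  Moore-unique (F-proper _ _ w) (F-proper _ _ w′) with refl ← While-unique w w′ = refl

RunningTime-unique : ∀ {A : Automaton k n} {t t′} →
                     RunningTime A t → RunningTime A t′ → t ≡ t′
RunningTime-unique (_ , m , refl) (_ , m′ , refl) = cong cost (Moore-unique m m′)

{-# OPTIONS --safe #-}
module Submission where

-- Two states are separated by F after j steps if the states reached from them
-- after j steps are separated by F. The labels after m rounds classify the states
-- by what happens up to step m, so the number ρ of refining rounds is the largest
-- first separation time of two states, and a round costs Θ(n).
--
-- Upper bound. For fixed states p and q and fixed transitions, let E k be the set
-- of F that do not separate p and q before step k, a subspace of (ℤ/2)ⁿ. If some F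
-- separates them for the first time at step l, then its translates along the
-- transition function show that E (k + 1) is a proper subspace of E k for all
-- k ≤ l, so E l has 2ⁿ⁻ˡ elements. Hence ρ ≤ n always, and the probability that
-- ρ > m is at most n² / 2ᵐ⁺¹; now take m ≈ 3 log n.
--
-- Lower bound. Let the last state be mapped to t. If F separates t - 1 from the
-- last state, then the states 0, …, t - 1 are pairwise inequivalent, hence have
-- pairwise distinct words of length ρ + 1, so t ≤ 2 ^ (ρ + 1). This happens for
-- half of all F, and t ≥ n / 2 holds for about half of all t.

open import Defs
open import Data.Bool using (Bool; T; _xor_; _∧_; false; if_then_else_; not; true)
import Data.Bool.Properties as Boolₚ
open import Data.Fin as Fin using (Fin; combine; fromℕ; inject₁; suc; toℕ; zero)
open import Data.Fin.Properties using (any?; combine-injective; fromℕ≢inject₁; injective⇒≤; toℕ-fromℕ; toℕ-fromℕ<; toℕ-injective; toℕ-inject₁; toℕ<n)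
open import Data.Fin.Subset using (Subset)
import Data.Integer as ℤ
import Data.Integer.Properties as ℤₚ
open import Data.List using (List; []; _++_; _ʳ++_; _∷_; allFin; cartesianProductWith; downFrom; filter; foldl; length; map; reverse; tabulate)
import Data.List.Membership.DecPropositional as DecMembership
open import Data.List.Membership.Propositional using (_∈_; _∉_)
open import Data.List.Membership.Propositional.Properties using (∈-++⁺ʳ; ∈-++⁺ˡ; ∈-allFin; ∈-filter⁺; ∈-map⁺; ∈-map⁻)
open import Data.List.Properties using (filter-accept; filter-reject; foldl-cong; length-++; length-downFrom; length-filter; length-map; length-reverse; length-tabulate; length-ʳ++; map-++; map-cong; map-tabulate; map-∘; ʳ++-ʳ++)
open import Data.List.Relation.Unary.All as All using (All; []; _∷_)
open import Data.List.Relation.Unary.All.Properties as AllP using (all-filter)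
open import Data.List.Relation.Unary.AllPairs as AllPairs using (AllPairs; []; _∷_)
import Data.List.Relation.Unary.AllPairs.Properties as AllPairsP
open import Data.List.Relation.Unary.Any using (here; there)
open import Data.List.Relation.Unary.Any.Properties using (reverse⁺)
open import Data.Maybe using (just; nothing)
open import Data.Nat using (NonZero; _*_; _+_; _<_; _^_; _∸_; _≟_; _≡ᵇ_; _≤_; _≤ᵇ_; suc; s≤s; zero; z≤n; ℕ; ⌈_/2⌉; ⌊_/2⌋)
open import Data.Nat.ListAction using (sum)
open import Data.Nat.ListAction.Properties using (sum-++)
open import Data.Nat.Logarithm using (⌊log₂[2^n]⌋≡n; ⌊log₂_⌋; ⌊log₂⌋-mono-≤)
open import Data.Nat.Properties hiding (_≟_)
open import Data.Nat.Solver using (module +-*-Solver)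
open import Data.Product using (_,_; _×_; proj₁; proj₂; Σ-syntax; ∃-syntax)
import Data.Rational.Unnormalised as ℚ
open import Data.Sum using (_⊎_; inj₁; inj₂)
open import Data.Unit using (tt; ⊤)
open import Data.Vec as Vec using (Vec; []; _∷_; lookup; zipWith)
open import Data.Vec.Properties using (lookup-replicate; lookup-zipWith; lookup∘tabulate; lookup∘update; lookup∘update′)
open import Function using (_∘_)
open import Relation.Binary.Definitions using (tri<; tri>; tri≈)
open import Relation.Binary.PropositionalEquality
open import Relation.Nullary using (Dec; contradiction; does; no; ofʸ; proof; yes; ¬?; ¬_)
open import Relation.Nullary.Decidable using (_×-dec_; dec-false; dec-true; decidable-stable)

open ℚ using (mkℚᵘ; _/_; *≤*; *<*)
open +-*-Solver using (solve; con; _:+_; _:*_; _:=_)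

private variable
  n : ℕ
  S X Y Z : Set

-- Values and costs of loops

forEach-value : ∀ (is : List X) (s : S) (body : S → X → Time S) →
                value (forEach is s body) ≡ foldl (λ s i → value (body s i)) s is
forEach-value []       s body = refl
forEach-value (i ∷ is) s body = forEach-value is _ body

forEach-cost : ∀ (is : List X) (s : S) (body : S → X → Time S) c → (∀ s i → cost (body s i) ≡ c) →
               cost (forEach is s body) ≡ 1 + length is * suc c
forEach-cost []       s body c eq = refl
forEach-cost (i ∷ is) s body c eq = cong suc (begin
  cost (body s i) + cost (forEach is (value (body s i)) body)
    ≡⟨ cong₂ _+_ (eq s i) (forEach-cost is _ body c eq) ⟩
  c + (1 + length is * suc c)
    ≡⟨ +-suc c _ ⟩
  suc (c + length is * suc c) ∎)
  where open ≡-Reasoning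

-- The value written to a cell depends only on the cell, so a cell that is correct once stays
-- correct. The disjunction in the hypothesis is the loop invariant.
foldl-write : (g : Fin n → X) (ps : List (Fin n)) (a : Fin n → X) {p : Fin n} → p ∈ ps ⊎ a p ≡ g p →
              foldl (λ a i j → if does (i Fin.≟ j) then g i else a j) a ps p ≡ g p
foldl-write g []       a     (inj₂ eq) = eq
foldl-write g (i ∷ ps) a {p} h = foldl-write g ps _ (stepped h)
  where
  stepped : p ∈ i ∷ ps ⊎ a p ≡ g p → p ∈ ps ⊎ (if does (i Fin.≟ p) then g i else a p) ≡ g p
  stepped h with i Fin.≟ p
  ... | yes refl = inj₂ refl
  stepped (inj₁ (here eq)) | no i≢p = contradiction (sym eq) i≢p
  stepped (inj₁ (there m)) | no i≢p = inj₁ m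
  stepped (inj₂ eq)        | no i≢p = inj₂ eq

write-loop : ∀ (g : Fin n → X) (a : Fin n → X) (body : (Fin n → X) → Fin n → Time (Fin n → X)) →
             (∀ a i → value (body a i) ≡ λ j → if does (i Fin.≟ j) then g i else a j) →
             ∀ p → value (forEach (allFin n) a body) p ≡ g p
write-loop {n} g a body eq p = trans (cong (λ f → f p)
  (trans (forEach-value (allFin n) a body) (foldl-cong eq a (allFin n))))
  (foldl-write g (allFin n) a (inj₁ (∈-allFin p)))

-- Ranks of keys in a sorted list

-- The label that numbering gives to the key u, when the previous key is t with
-- label l and the keys xs remain.
rank : ℕ → ℕ → List ℕ → ℕ → ℕ
rank t l []       u = l
rank t l (x ∷ xs) u = if t ≡ᵇ u then l else rank x (if t ≡ᵇ x then l else suc l) xs u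

rank-self : ∀ t l xs → rank t l xs t ≡ l
rank-self t l []       = refl
rank-self t l (x ∷ xs) rewrite dec-true (t ≟ t) refl = refl

if-≤ : ∀ {c x u : ℕ} b → c ≤ x → c ≤ u → c ≤ (if b then x else u)
if-≤ true  c≤x c≤u = c≤x
if-≤ false c≤x c≤u = c≤u

if-≥ : ∀ {c x u : ℕ} b → x ≤ c → u ≤ c → (if b then x else u) ≤ c
if-≥ true  x≤c u≤c = x≤c
if-≥ false x≤c u≤c = u≤c

rank-lower : ∀ t l xs u → l ≤ rank t l xs u
rank-lower t l []       u = ≤-refl
rank-lower t l (x ∷ xs) u = if-≤ (t ≡ᵇ u) ≤-refl
  (≤-trans (if-≤ (t ≡ᵇ x) ≤-refl (n≤1+n l)) (rank-lower x _ xs u))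

-- If `t` equals `u`, then `x` is squeezed between them and the label does not change. On sorted
-- keys the early exit of `rank` therefore agrees with the recursive call.
rank-step : ∀ {t x u l xs} → t ≤ x → x ≤ u → rank t l (x ∷ xs) u ≡ rank x (if t ≡ᵇ x then l else suc l) xs u
rank-step {t} {x} {u} {l} {xs} t≤x x≤u with t ≟ u
... | no t≢u rewrite dec-false (t ≟ u) t≢u = refl
... | yes refl rewrite ≤-antisym x≤u t≤x | dec-true (t ≟ t) refl = sym (rank-self t l xs)

head-≤ : ∀ {t u xs} → AllPairs _≤_ (t ∷ xs) → u ∈ t ∷ xs → t ≤ u
head-≤ _       (here refl) = ≤-refl
head-≤ (h ∷ _) (there m)   = All.lookup h m

tail-∈ : ∀ {t u : ℕ} {xs} → t ≢ u → u ∈ t ∷ xs → u ∈ xs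
tail-∈ ne (here eq) = contradiction (sym eq) ne
tail-∈ ne (there m) = m

-- Labels never decrease along the list, so strictness comes from the place where the keys leave
-- `u`: there `t ≢ x`, and the label is incremented.
rank-mono-< : ∀ {u v} t l xs → AllPairs _≤_ (t ∷ xs) → u ∈ t ∷ xs → v ∈ t ∷ xs → u < v →
              rank t l xs u < rank t l xs v
rank-mono-< t l [] _ (here refl) (here refl) u<v = contradiction u<v (<-irrefl refl)
rank-mono-< {u} {v} t l (x ∷ xs) sorted@(_ ∷ sorted′) u∈ v∈ u<v
  rewrite dec-false (t ≟ v) (<⇒≢ (≤-<-trans (head-≤ sorted u∈) u<v))
  with t ≟ u
... | no t≢u rewrite dec-false (t ≟ u) t≢u =
  rank-mono-< x _ xs sorted′ (tail-∈ t≢u u∈) (tail-∈ (<⇒≢ (≤-<-trans (head-≤ sorted u∈) u<v)) v∈) u<v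
... | yes refl rewrite dec-true (t ≟ t) refl with t ≟ x
... | yes refl rewrite dec-true (t ≟ t) refl =
  subst (_< rank t l xs v) (rank-self t l xs)
    (rank-mono-< t l xs sorted′ (here refl) (tail-∈ (<⇒≢ u<v) v∈) u<v)
... | no t≢x rewrite dec-false (t ≟ x) t≢x = rank-lower x (suc l) xs v

-- The label grows by at most one from each key to the next, so no value is skipped.
rank-onto : ∀ {c u} t l xs → AllPairs _≤_ (t ∷ xs) → l ≤ c → c ≤ rank t l xs u →
            ∃[ v ] v ∈ t ∷ xs × rank t l xs v ≡ c
rank-onto {c} t l [] sorted l≤c c≤ = t , here refl , ≤-antisym l≤c c≤
rank-onto {c} {u} t l (x ∷ xs) sorted@(h ∷ sorted′) l≤c c≤ with l ≟ c
... | yes refl = t , here refl , rank-self t l (x ∷ xs)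
... | no l≢c with t ≡ᵇ u
... | true = contradiction (≤-antisym l≤c c≤) l≢c
... | false with rank-onto {c} {u} x _ xs sorted′ (if-≥ (t ≡ᵇ x) l≤c (≤∧≢⇒< l≤c l≢c)) c≤
... | v , v∈ , eq = v , there v∈ , trans (rank-step {xs = xs} (All.head h) (head-≤ sorted′ v∈)) eq

-- Tuple comparison and bucket sort

sameTuple-cost : ∀ {k} (t u : Vec ℕ k) → cost (sameTuple t u) ≡ 1 + 2 * k
sameTuple-cost []      []      = refl
sameTuple-cost {suc k} (_ ∷ t) (_ ∷ u) rewrite sameTuple-cost t u | *-suc 2 k | +-comm (2 * k) 1 = refl

module _ (key : X → ℕ) where

  bucket : List X → ℕ → List X
  bucket ps l = filter (λ p → key p ≟ l) ps

  -- Filling at the front reverses each bucket, hence `_ʳ++_`; emptying will reverse it back.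
  fillBuckets : ∀ (ps : List X) (buckets : ℕ → List X) l →
                foldl (λ bs p j → if does (key p ≟ j) then p ∷ bs (key p) else bs j) buckets ps l
                ≡ bucket ps l ʳ++ buckets l
  fillBuckets []       buckets l = refl
  fillBuckets (p ∷ ps) buckets l rewrite fillBuckets ps (λ j → if does (key p ≟ j) then p ∷ buckets (key p) else buckets j) l
    with key p ≡ᵇ l | proof (key p ≟ l)
  ... | true  | ofʸ refl = refl
  ... | false | _        = refl

  -- The emptying phase, with the two reversals of each bucket already cancelled.
  collect : List X → ℕ → List X → List X
  collect ps m out = foldl (λ out l → bucket ps l ++ out) out (downFrom m)

  collect-∈ : ∀ {ps out p} m → (p ∈ ps × key p < m) ⊎ p ∈ out → p ∈ collect ps m out
  collect-∈ zero    (inj₂ p∈) = p∈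
  collect-∈ {ps} (suc m) (inj₂ p∈) = collect-∈ {ps} m (inj₂ (∈-++⁺ʳ (bucket ps m) p∈))
  collect-∈ {ps} {p = p} (suc m) (inj₁ (p∈ , s≤s le)) with key p ≟ m
  ... | yes eq = collect-∈ {ps} m (inj₂ (∈-++⁺ˡ (∈-filter⁺ (λ p → key p ≟ m) p∈ eq)))
  ... | no ¬eq = collect-∈ {ps} m (inj₁ (p∈ , ≤∧≢⇒< le ¬eq))

  module _ (R : X → X → Set) where

    -- Lexicographic order with the previous order `R` as tie-break, which expresses the stability
    -- of the sort.
    Then : X → X → Set
    Then p q = key p < key q ⊎ (key p ≡ key q × R p q)

    bucket-sorted : ∀ l {ps} → All (λ p → key p ≡ l) ps → AllPairs R ps → AllPairs Then ps
    bucket-sorted l []         []       = []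
    bucket-sorted l (eq ∷ eqs) (r ∷ rs) =
      All.zipWith (λ (e , r) → inj₂ (trans eq (sym e) , r)) (eqs , r) ∷ bucket-sorted l eqs rs

    -- Buckets are prepended in decreasing order of their key, so all elements already in the output
    -- have larger keys. Inside a bucket, filtering preserves `R`.
    collect-sorted : ∀ {ps} m {out} → AllPairs R ps → AllPairs Then out → All (λ p → m ≤ key p) out →
                     AllPairs Then (collect ps m out)
    collect-sorted zero    _  out _ = out
    collect-sorted {ps} (suc m) rs out bounds = collect-sorted m rs
      (AllPairsP.++⁺ (bucket-sorted m (all-filter (λ p → key p ≟ m) ps) (AllPairsP.filter⁺ (λ p → key p ≟ m) rs)) out
        (All.map (λ { refl → All.map inj₁ bounds }) (all-filter (λ p → key p ≟ m) ps)))
      (AllP.++⁺ (All.map (≤-reflexive ∘ sym) (all-filter (λ p → key p ≟ m) ps)) (All.map <⇒≤ bounds))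

  -- Counts the elements that survive when only the buckets below `m` are collected. With it, the
  -- cost of sorting can be bounded without any bound on the keys.
  below : List X → ℕ → ℕ
  below ps m = length (filter (λ p → key p <? m) ps)

  below-suc : ∀ ps m → below ps (suc m) ≡ length (bucket ps m) + below ps m
  below-suc [] m = refl
  below-suc (p ∷ ps) m with <-cmp (key p) m
  ... | tri< lt ¬eq _
    rewrite filter-accept (λ p → key p <? suc m) {p} {ps} (m<n⇒m<1+n lt)
          | filter-reject (λ p → key p ≟ m) {p} {ps} ¬eq
          | filter-accept (λ p → key p <? m) {p} {ps} lt
          | +-suc (length (bucket ps m)) (below ps m) = cong suc (below-suc ps m)
  ... | tri≈ ¬lt eq _
    rewrite filter-accept (λ p → key p <? suc m) {p} {ps} (s≤s (≤-reflexive eq))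
          | filter-accept (λ p → key p ≟ m) {p} {ps} eq
          | filter-reject (λ p → key p <? m) {p} {ps} ¬lt = cong suc (below-suc ps m)
  ... | tri> ¬lt ¬eq gt
    rewrite filter-reject (λ p → key p <? suc m) {p} {ps} (λ lt → <⇒≱ gt (≤-pred lt))
          | filter-reject (λ p → key p ≟ m) {p} {ps} ¬eq
          | filter-reject (λ p → key p <? m) {p} {ps} ¬lt = below-suc ps m

  collect-length : ∀ ps m out → length (collect ps m out) ≡ below ps m + length out
  collect-length ps zero    out = cong (λ z → z + length out) (sym (none ps))
    where
    none : ∀ ps → below ps 0 ≡ 0
    none []       = refl
    none (p ∷ ps) = none ps
  collect-length ps (suc m) out rewrite collect-length ps m (bucket ps m ++ out)
    | length-++ (bucket ps m) {out} | below-suc ps m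
    | +-comm (length (bucket ps m)) (below ps m) = sym (+-assoc (below ps m) _ _)

-- Canonical labellings

Canonical : Labels n → Set
Canonical π = ∀ p c → c ≤ π p → ∃[ q ] π q ≡ c

Bounded : Labels n → Set
Bounded {n} π = ∀ p → π p < n

-- Choosing a state for each of the labels `0`, ..., `π p` gives an injection of `suc (π p)`
-- elements into the `n` states.
canonical⇒bounded : ∀ {π : Labels n} → Canonical π → Bounded π
canonical⇒bounded {n} {π} canonical p = injective⇒≤ {f = λ i → proj₁ (canonical p (toℕ i) (≤-pred (toℕ<n i)))}
  λ {i} {j} eq → toℕ-injective (trans (sym (proj₂ (canonical p (toℕ i) _))) (trans (cong π eq) (proj₂ (canonical p (toℕ j) _))))

-- A state with label `suc c` has a state with label `c` strictly below it, so both inequalities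
-- follow by induction on the label. This is why comparing label arrays amounts to comparing
-- partitions.
canonical-unique : ∀ {π π′ : Labels n} → Canonical π → Canonical π′ →
                   (∀ p q → π p ≡ π q → π′ p ≡ π′ q) → (∀ p q → π p < π q → π′ p < π′ q) → ∀ p → π p ≡ π′ p
canonical-unique {n} {π} {π′} can can′ mono-≡ mono-< p = ≤-antisym (up (π p) p refl) (down (π′ p) p refl)
  where
  up : ∀ c p → π p ≡ c → c ≤ π′ p
  up zero    p eq = z≤n
  up (suc c) p eq with q , e ← can p c (subst (c ≤_) (sym eq) (n≤1+n c)) =
    ≤-<-trans (up c q e) (mono-< q p (≤-reflexive (trans (cong suc e) (sym eq))))

  down : ∀ c p → π′ p ≡ c → c ≤ π p
  down zero    p eq = z≤n
  down (suc c) p eq with can′ p c (subst (c ≤_) (sym eq) (n≤1+n c))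
  ... | q , e with <-cmp (π q) (π p)
  ... | tri< lt _ _ = ≤-<-trans (down c q e) lt
  ... | tri≈ _ e′ _ = contradiction (trans (sym eq) (trans (sym (mono-≡ q p e′)) e)) 1+n≢n
  ... | tri> _ _ gt = contradiction (subst₂ _<_ eq e (mono-< p q gt)) (≤⇒≯ (n≤1+n c))

-- Conjunctions over lists, and pairs as numbers in base n

and-loop : ∀ (f : X → Bool) b ps → foldl (λ b p → b ∧ f p) b ps ≡ true →
           b ≡ true × (∀ {p} → p ∈ ps → f p ≡ true)
and-loop f b []       eq = eq , λ ()
and-loop f b (p ∷ ps) eq with and-loop f (b ∧ f p) ps eq
and-loop f true (p ∷ ps) eq | head , tail = refl , λ { (here refl) → head ; (there m) → tail m }

and-loop-true : ∀ (f : X → Bool) → (∀ p → f p ≡ true) → ∀ ps → foldl (λ b p → b ∧ f p) true ps ≡ true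
and-loop-true f all []       = refl
and-loop-true f all (p ∷ ps) rewrite all p = and-loop-true f all ps

-- With last digits below `n`, numerals in base `n` are ordered lexicographically. This turns the
-- order on tuples into the order on ℕ, to which `rank` applies.
code-mono : ∀ {n a a′ b b′} → b < n → a < a′ ⊎ (a ≡ a′ × b < b′) → a * n + b < a′ * n + b′
code-mono {n} {a} {a′} {b} {b′} b<n (inj₁ a<a′) = begin-strict
  a * n + b   <⟨ +-monoʳ-< (a * n) b<n ⟩
  a * n + n   ≡⟨ +-comm (a * n) n ⟩
  suc a * n   ≤⟨ *-monoˡ-≤ n a<a′ ⟩
  a′ * n      ≤⟨ m≤m+n _ b′ ⟩
  a′ * n + b′ ∎
  where open ≤-Reasoning
code-mono {n} {a} _ (inj₂ (refl , b<b′)) = +-monoʳ-< (a * n) b<b′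

code-injective : ∀ {n a a′ b b′} → b < n → b′ < n → a * n + b ≡ a′ * n + b′ → a ≡ a′ × b ≡ b′
code-injective {a = a} {a′} {b} {b′} b<n b′<n eq with <-cmp a a′ | <-cmp b b′
... | tri< lt _ _   | _            = contradiction eq (<⇒≢ (code-mono b<n (inj₁ lt)))
... | tri> _ _ gt   | _            = contradiction (sym eq) (<⇒≢ (code-mono b′<n (inj₁ gt)))
... | tri≈ _ refl _ | tri< lt _ _  = contradiction eq (<⇒≢ (code-mono {a = a} b<n (inj₂ (refl , lt))))
... | tri≈ _ refl _ | tri≈ _ e _   = refl , e
... | tri≈ _ refl _ | tri> _ _ gt  = contradiction (sym eq) (<⇒≢ (code-mono {a = a} b′<n (inj₂ (refl , gt))))

same-code : ∀ {n a a′ b b′} → b < n → b′ < n →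
            value (sameTuple (a ∷ b ∷ []) (a′ ∷ b′ ∷ [])) ≡ (a * n + b ≡ᵇ a′ * n + b′)
same-code {n} {a} {a′} {b} {b′} b<n b′<n with a ≟ a′ | b ≟ b′
... | yes refl | yes refl rewrite dec-true (a ≟ a) refl | dec-true (b ≟ b) refl | dec-true (a * n + b ≟ a * n + b) refl = refl
... | yes refl | no b≢b′ rewrite dec-true (a ≟ a) refl | dec-false (b ≟ b′) b≢b′ =
  sym (dec-false (a * n + b ≟ a * n + b′) (b≢b′ ∘ proj₂ ∘ code-injective {a = a} {a} b<n b′<n))
... | no a≢a′ | _ rewrite dec-false (a ≟ a′) a≢a′ =
  sym (dec-false (a * n + b ≟ a′ * n + b′) (a≢a′ ∘ proj₁ ∘ code-injective {a = a} {a′} b<n b′<n))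

-- Costs of the phases, and correctness of one refinement

module Refine (A : Automaton 1 n) where

  s : Fin n → Fin n
  s p = δ A p zero

  open DecMembership (Fin._≟_ {n}) using (_∈?_)

  length-states : length (states A) ≡ n
  length-states = length-tabulate (λ i → i)

  initial-value : ∀ p → value (initial A) p ≡ (if lookup (F A) p then 1 else 0)
  initial-value = write-loop (λ p → if lookup (F A) p then 1 else 0) _ _ (λ _ _ → refl)

  initial-cost : cost (initial A) ≡ n + (1 + n * 4)
  initial-cost = cong (n +_) (trans (forEach-cost (states A) _ _ 3 (λ _ _ → refl))
    (cong (λ m → 1 + m * 4) length-states))

  finality-cost : cost (finality A) ≡ 1 + n * 4
  finality-cost = trans (forEach-cost (states A) _ _ 3 (λ _ _ → refl)) (cong (λ m → 1 + m * 4) length-states)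

  quotient-cost : ∀ π → cost (quotient A π) ≡ n + (n + (1 + (1 + n * 10)))
  quotient-cost π = cong (λ m → n + (n + (1 + m))) (trans (forEach-cost (states A) _ _ _ (λ _ _ → refl))
    (cong (λ m → 1 + m * 10) length-states))

  signatures-value : ∀ π p → value (signatures A π) p ≡ π p ∷ π (s p) ∷ []
  signatures-value π = write-loop (λ p → π p ∷ π (s p) ∷ []) _ _ (λ _ _ → refl)

  signatures-cost : ∀ π → cost (signatures A π) ≡ n + (1 + n * 8)
  signatures-cost π = cong (n +_) (trans (forEach-cost (states A) _ _ _ (λ _ _ → refl))
    (cong (λ m → 1 + m * 8) length-states))

  different-cost : ∀ π π′ → cost (different A (just π , π′)) ≡ 2 + n * 5
  different-cost π π′ = trans (+-comm _ 1) (cong suc (trans (forEach-cost (states A) true _ _ (λ _ _ → refl))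
    (cong (λ m → 1 + m * 5) length-states)))

  different-false⇒≡ : ∀ π π′ → value (different A (just π , π′)) ≡ false → ∀ p → π p ≡ π′ p
  different-false⇒≡ π π′ eq p = ≡ᵇ⇒≡ (π p) (π′ p) (subst T (sym (proj₂ (and-loop (λ p → π p ≡ᵇ π′ p) true (states A)
    (trans (sym (forEach-value (states A) true _)) (not-false eq))) (∈-allFin p))) tt)
    where
    not-false : ∀ {b} → not b ≡ false → b ≡ true
    not-false {true} _ = refl

  ≡⇒different-false : ∀ π π′ → (∀ p → π p ≡ π′ p) → value (different A (just π , π′)) ≡ false
  ≡⇒different-false π π′ eq = cong not (trans (forEach-value (states A) true _)
    (and-loop-true (λ p → π p ≡ᵇ π′ p) (λ p → dec-true (π p ≟ π′ p) (eq p)) (states A)))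

  module _ (sg : Signatures A) where

    module _ (j : Fin 2) where

      key : Fin n → ℕ
      key p = lookup (sg p) j

      filling : List (Fin n) → Time (Array ℕ (List (Fin n)))
      filling ps = forEach ps (λ _ → []) λ buckets p →
        read sg p >>= λ t → op (lookup t j) >>= λ l → read buckets l >>= λ qs → op (p ∷ qs) >>= λ qs′ → write _≟_ buckets l qs′

      emptying : Array ℕ (List (Fin n)) → List (Fin n) → ℕ → Time (List (Fin n))
      emptying buckets out l = read buckets l >>= λ qs → forEach qs out λ out q → op (q ∷ out)

      -- Each bucket costs 3 and each moved state costs 2; the moved states are counted by the
      -- growth of the output. The old length stands on the left to avoid subtraction.
      emptying-cost : ∀ buckets ls out → let r = forEach ls out (emptying buckets) in
                      cost r + 2 * length out ≡ 1 + 3 * length ls + 2 * length (value r)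
      emptying-cost buckets []       out = refl
      emptying-cost buckets (l ∷ ls) out = begin
        2 + (c₀ + c′) + 2 * length out
          ≡⟨ cong (λ x → 2 + (x + c′) + 2 * length out) (forEach-cost (buckets l) out _ 1 (λ _ _ → refl)) ⟩
        2 + (1 + length (buckets l) * 2 + c′) + 2 * length out
          ≡⟨ solve 3 (λ b c o → con 2 :+ (con 1 :+ b :* con 2 :+ c) :+ con 2 :* o := con 3 :+ (c :+ con 2 :* (b :+ o))) refl
               (length (buckets l)) c′ (length out) ⟩
        3 + (c′ + 2 * (length (buckets l) + length out))
          ≡⟨ cong (λ m → 3 + (c′ + 2 * m)) (sym (trans (cong length (forEach-value (buckets l) out _)) (length-ʳ++ (buckets l)))) ⟩
        3 + (c′ + 2 * length out′)
          ≡⟨ cong (3 +_) (emptying-cost buckets ls out′) ⟩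
        3 + (1 + 3 * length ls + 2 * length v₀)
          ≡⟨ solve 2 (λ a v → con 3 :+ (con 1 :+ con 3 :* a :+ con 2 :* v) := con 1 :+ con 3 :* (con 1 :+ a) :+ con 2 :* v) refl
               (length ls) (length v₀) ⟩
        1 + 3 * suc (length ls) + 2 * length v₀ ∎
        where
        open ≡-Reasoning
        out′ = value (emptying buckets out l)
        c₀ = cost (forEach (buckets l) out λ out q → op (q ∷ out))
        c′ = cost (forEach ls out′ (emptying buckets))
        v₀ = value (forEach ls out′ (emptying buckets))

      bucketSort-value : ∀ ps → value (bucketSort A sg j ps) ≡ collect key ps n []
      bucketSort-value ps = trans (forEach-value (downFrom n) [] _) (foldl-cong (λ out l → begin
        value (emptying buckets out l)         ≡⟨ forEach-value (buckets l) out (λ out q → op (q ∷ out)) ⟩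
        buckets l ʳ++ out                      ≡⟨ cong (_ʳ++ out) (trans (cong (λ f → f l) (forEach-value ps (λ _ → []) (λ bs p → (λ j → if does (key p ≟ j) then p ∷ bs (key p) else bs j) after 5))) (fillBuckets key ps _ l)) ⟩
        (bucket key ps l ʳ++ []) ʳ++ out       ≡⟨ ʳ++-ʳ++ (bucket key ps l) ⟩
        bucket key ps l ++ out                 ∎) [] (downFrom n))
        where
        open ≡-Reasoning
        buckets = value (filling ps)

      bucketSort-length : ∀ ps → length (value (bucketSort A sg j ps)) ≤ length ps
      bucketSort-length ps = begin
        length (value (bucketSort A sg j ps)) ≡⟨ cong length (bucketSort-value ps) ⟩
        length (collect key ps n [])          ≡⟨ collect-length key ps n [] ⟩
        below key ps n + 0                    ≡⟨ +-identityʳ _ ⟩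
        below key ps n                        ≤⟨ length-filter _ ps ⟩
        length ps                             ∎
        where open ≤-Reasoning

      bucketSort-cost : ∀ ps → length ps ≤ n → cost (bucketSort A sg j ps) ≤ 12 * n + 2
      bucketSort-cost ps len = begin
        n + (a + b)                                          ≡⟨ cong (λ a → n + (a + b)) (forEach-cost ps _ _ 5 (λ _ _ → refl)) ⟩
        n + (1 + length ps * 6 + b)                          ≡⟨ cong (λ b → n + (1 + length ps * 6 + b)) (sym (+-identityʳ b)) ⟩
        n + (1 + length ps * 6 + (b + 0))                    ≡⟨ cong (λ b → n + (1 + length ps * 6 + b)) (emptying-cost (value (filling ps)) (downFrom n) []) ⟩
        n + (1 + length ps * 6 + (1 + 3 * length (downFrom n) + 2 * length (value (bucketSort A sg j ps))))
          ≡⟨ cong (λ m → n + (1 + length ps * 6 + (1 + 3 * m + 2 * length (value (bucketSort A sg j ps))))) (length-downFrom n) ⟩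
        n + (1 + length ps * 6 + (1 + 3 * n + 2 * length (value (bucketSort A sg j ps))))
          ≤⟨ +-monoʳ-≤ n (+-mono-≤ (+-monoʳ-≤ 1 (*-monoˡ-≤ 6 len))
               (+-monoʳ-≤ (1 + 3 * n) (*-monoʳ-≤ 2 (≤-trans (bucketSort-length ps) len)))) ⟩
        n + (1 + n * 6 + (1 + 3 * n + 2 * n))
          ≡⟨ solve 1 (λ n → n :+ (con 1 :+ n :* con 6 :+ (con 1 :+ con 3 :* n :+ con 2 :* n)) := con 12 :* n :+ con 2) refl n ⟩
        12 * n + 2                                           ∎
        where
        open ≤-Reasoning
        a = cost (filling ps)
        b = cost (forEach (downFrom n) [] (emptying (value (filling ps))))

      bucketSort-sorted : ∀ (R : Fin n → Fin n → Set) ps → AllPairs R ps → AllPairs (Then key R) (value (bucketSort A sg j ps))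
      bucketSort-sorted R ps rs = subst (AllPairs (Then key R)) (sym (bucketSort-value ps))
        (collect-sorted key R n rs [] [])

      bucketSort-∈ : (∀ p → key p < n) → ∀ {ps p} → p ∈ ps → p ∈ value (bucketSort A sg j ps)
      bucketSort-∈ key<n {ps} {p} p∈ = subst (p ∈_) (sym (bucketSort-value ps)) (collect-∈ key n (inj₁ (p∈ , key<n p)))

    firstPass : Time (List (Fin n))
    firstPass = forEach (states A) [] λ ps p → op (p ∷ ps)

    firstPass-value : value firstPass ≡ reverse (states A)
    firstPass-value = forEach-value (states A) [] _

    secondPass : List (Fin n)
    secondPass = value (bucketSort A sg (suc zero) (value firstPass))

    firstPass-length : length (value firstPass) ≤ n
    firstPass-length = ≤-reflexive (trans (cong length firstPass-value) (trans (length-reverse (states A)) length-states))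

    secondPass-length : length secondPass ≤ n
    secondPass-length = ≤-trans (bucketSort-length (suc zero) (value firstPass)) firstPass-length

    radixSort-length : length (value (radixSort A sg)) ≤ n
    radixSort-length = ≤-trans (bucketSort-length zero secondPass) secondPass-length

    radixSort-cost : cost (radixSort A sg) ≤ 26 * n + 5
    radixSort-cost = begin
      cost firstPass + a + b
        ≤⟨ +-mono-≤ (+-mono-≤ (≤-reflexive (trans (forEach-cost (states A) [] _ 1 (λ _ _ → refl))
                                  (cong (λ m → 1 + m * 2) length-states)))
             (bucketSort-cost (suc zero) (value firstPass) firstPass-length))
             (bucketSort-cost zero secondPass secondPass-length) ⟩
      1 + n * 2 + (12 * n + 2) + (12 * n + 2)
        ≡⟨ solve 1 (λ n → con 1 :+ n :* con 2 :+ (con 12 :* n :+ con 2) :+ (con 12 :* n :+ con 2) := con 26 :* n :+ con 5) refl n ⟩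
      26 * n + 5 ∎
      where
      open ≤-Reasoning
      a = cost (bucketSort A sg (suc zero) (value firstPass))
      b = cost (bucketSort A sg zero secondPass)

    number-cost : ∀ t l π ps → cost (number A sg t l π ps) ≡ 1 + length ps * 8
    number-cost t l π []       = refl
    number-cost t l π (p ∷ ps) rewrite sameTuple-cost t (sg p) = cong (8 +_) (number-cost _ _ _ ps)

    numbering-cost : ∀ ps → length ps ≤ n → cost (numbering A sg ps) ≤ 9 * n + 2
    numbering-cost []       _   = ≤-trans (m≤m+n n (8 * n)) (m≤m+n (9 * n) 2)
    numbering-cost (p ∷ ps) len = begin
      n + (1 + cost (number A sg (sg p) 0 (λ _ → 0) (p ∷ ps))) ≡⟨ cong (λ c → n + (1 + c)) (number-cost (sg p) 0 _ (p ∷ ps)) ⟩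
      n + (1 + (1 + length (p ∷ ps) * 8)) ≤⟨ +-monoʳ-≤ n (+-monoʳ-≤ 2 (*-monoˡ-≤ 8 len)) ⟩
      n + (2 + n * 8) ≡⟨ solve 1 (λ n → n :+ (con 2 :+ n :* con 8) := con 9 :* n :+ con 2) refl n ⟩
      9 * n + 2 ∎
      where open ≤-Reasoning

    number-∉ : ∀ t l π ps {q} → q ∉ ps → value (number A sg t l π ps) q ≡ π q
    number-∉ t l π []       q∉ = refl
    number-∉ t l π (p ∷ ps) {q} q∉ = trans (number-∉ (sg p) _ _ ps (q∉ ∘ there)) (unwritten (p Fin.≟ q))
      where
      unwritten : ∀ {x y : ℕ} (d : Dec (p ≡ q)) → (if does d then x else y) ≡ y
      unwritten (yes refl) = contradiction (here refl) q∉
      unwritten (no _)     = refl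

    module _ (code : Fin n → ℕ) (same : ∀ p q → value (sameTuple (sg p) (sg q)) ≡ (code p ≡ᵇ code q)) where

      -- The list may contain repetitions. If `q` occurs again in `ps`, the later write decides and
      -- `rank-step` moves on; otherwise the label written now survives by `number-∉`.
      number-value : ∀ p₀ l π ps {q} → AllPairs _≤_ (code p₀ ∷ map code ps) → q ∈ ps →
                     value (number A sg (sg p₀) l π ps) q ≡ rank (code p₀) l (map code ps) (code q)
      number-value p₀ l π (p ∷ ps) {q} sorted@(h ∷ sorted′) q∈ rewrite same p₀ p with q ∈? ps
      ... | yes q∈ps = trans (number-value p _ _ ps sorted′ q∈ps)
        (sym (rank-step {xs = map code ps} (All.head h) (head-≤ sorted′ (there (∈-map⁺ code q∈ps)))))
      number-value p₀ l π (p ∷ ps) {q} sorted@(h ∷ sorted′) (there q∈) | no q∉ps = contradiction q∈ q∉ps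
      number-value p₀ l π (p ∷ ps) {q} sorted@(h ∷ sorted′) (here refl) | no q∉ps = begin
        value (number A sg (sg p) l′ π′ ps) p              ≡⟨ number-∉ (sg p) l′ π′ ps q∉ps ⟩
        π′ p                                               ≡⟨ written (p Fin.≟ p) ⟩
        l′                                                 ≡⟨ sym (rank-self (code p) l′ (map code ps)) ⟩
        rank (code p) l′ (map code ps) (code p)            ≡⟨ sym (rank-step {xs = map code ps} (All.head h) ≤-refl) ⟩
        rank (code p₀) l (code p ∷ map code ps) (code p)   ∎
        where
        open ≡-Reasoning
        l′ = if code p₀ ≡ᵇ code p then l else suc l
        π′ = λ j → if does (p Fin.≟ j) then l′ else π j
        written : ∀ {x y : ℕ} (d : Dec (p ≡ p)) → (if does d then x else y) ≡ x
        written (yes _) = refl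
        written (no ¬d) = contradiction refl ¬d

      record Ranks (π : Labels n) : Set where
        field
          rank-≡    : ∀ p q → code p ≡ code q → π p ≡ π q
          rank-<    : ∀ p q → code p < code q → π p < π q
          canonical : Canonical π

      numbering-ranks : ∀ ps → AllPairs (λ p q → code p ≤ code q) ps → (∀ p → p ∈ ps) → Ranks (value (numbering A sg ps))
      numbering-ranks [] _ all = record
        { rank-≡ = λ p → contradiction (all p) λ ()
        ; rank-< = λ p → contradiction (all p) λ ()
        ; canonical = λ p → contradiction (all p) λ () }
      numbering-ranks ps@(p₀ ∷ ps′) sorted all = record
        { rank-≡ = λ p q eq → trans (value-rank p) (trans (cong r eq) (sym (value-rank q)))
        ; rank-< = λ p q lt → subst₂ _<_ (sym (value-rank p)) (sym (value-rank q))
            (rank-mono-< (code p₀) 0 (map code ps) sorted′ (∈keys p) (∈keys q) lt)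
        ; canonical = onto }
        where
        r = rank (code p₀) 0 (map code ps)
        sorted″ : AllPairs _≤_ (map code ps)
        sorted″ = AllPairsP.map⁺ sorted
        -- The numbering starts with the tuple of the first state as its previous tuple, so the
        -- first key occurs twice and receives label 0.
        sorted′ : AllPairs _≤_ (code p₀ ∷ map code ps)
        sorted′ = All.tabulate (head-≤ sorted″) ∷ sorted″
        value-rank : ∀ q → value (numbering A sg ps) q ≡ r (code q)
        value-rank q = number-value p₀ 0 _ ps sorted′ (all q)
        ∈keys : ∀ p → code p ∈ code p₀ ∷ map code ps
        ∈keys p = there (∈-map⁺ code (all p))
        onto : Canonical (value (numbering A sg ps))
        onto p c c≤ with rank-onto {c} {code p} (code p₀) 0 (map code ps) sorted′ z≤n (subst (c ≤_) (value-rank p) c≤)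
        ... | v , here refl , eq = p₀ , trans (value-rank p₀) eq
        ... | v , there v∈ , eq with ∈-map⁻ code v∈
        ... | q , _ , refl = q , trans (value-rank q) eq

  refine-cost : ∀ π → cost (refine A π) ≤ 44 * n + 8
  refine-cost π = begin
    cost (signatures A π) + (cost (radixSort A sg) + cost (numbering A sg (value (radixSort A sg))))
      ≤⟨ +-mono-≤ (≤-reflexive (signatures-cost π)) (+-mono-≤ (radixSort-cost sg)
           (numbering-cost sg (value (radixSort A sg)) (radixSort-length sg))) ⟩
    n + (1 + n * 8) + (26 * n + 5 + (9 * n + 2))
      ≡⟨ solve 1 (λ n → n :+ (con 1 :+ n :* con 8) :+ (con 26 :* n :+ con 5 :+ (con 9 :* n :+ con 2)) := con 44 :* n :+ con 8) refl n ⟩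
    44 * n + 8 ∎
    where
    open ≤-Reasoning
    sg = value (signatures A π)

  refine-cost-lower : ∀ π → n ≤ cost (refine A π)
  refine-cost-lower π = ≤-trans (m≤m+n n _) (m≤m+n _ _)

  module _ (π : Labels n) (bounded : Bounded π) where

    private
      sg : Signatures A
      sg = value (signatures A π)

    code : Fin n → ℕ
    code p = π p * n + π (s p)

    key₀ : ∀ p → lookup (sg p) zero ≡ π p
    key₀ p = cong (λ t → lookup t zero) (signatures-value π p)

    key₁ : ∀ p → lookup (sg p) (suc zero) ≡ π (s p)
    key₁ p = cong (λ t → lookup t (suc zero)) (signatures-value π p)

    refine-ranks : Ranks sg code (λ p q → trans (cong₂ (λ t u → value (sameTuple t u)) (signatures-value π p) (signatures-value π q))
                                   (same-code {a = π p} {π q} (bounded (s p)) (bounded (s q))))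
                         (value (refine A π))
    refine-ranks = numbering-ranks sg code _ (value (radixSort A sg))
      -- The initial list satisfies only the trivial relation. Each stable pass adds one component
      -- in front of the order, and after two passes it is the order of the codes.
      (AllPairs.map sorted (bucketSort-sorted sg zero _ (secondPass sg) (bucketSort-sorted sg (suc zero) (λ _ _ → ⊤) (value (firstPass sg)) trivial)))
      (λ p → bucketSort-∈ sg zero (λ p → subst (_< n) (sym (key₀ p)) (bounded p))
        (bucketSort-∈ sg (suc zero) (λ p → subst (_< n) (sym (key₁ p)) (bounded (s p)))
          (subst (p ∈_) (sym (firstPass-value sg)) (reverse⁺ (∈-allFin p)))))
      where
      trivial : ∀ {ps : List (Fin n)} → AllPairs (λ _ _ → ⊤) ps
      trivial {[]}     = []
      trivial {p ∷ ps} = All.tabulate (λ _ → tt) ∷ trivial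
      sorted : ∀ {p q} → Then (key sg zero) (Then (key sg (suc zero)) (λ _ _ → ⊤)) p q → code p ≤ code q
      sorted {p} {q} rewrite key₀ p | key₀ q | key₁ p | key₁ q = λ
        { (inj₁ lt)                   → <⇒≤ (code-mono (bounded (s p)) (inj₁ lt))
        ; (inj₂ (eq , inj₁ lt))       → <⇒≤ (code-mono {a = π p} (bounded (s p)) (inj₂ (eq , lt)))
        ; (inj₂ (eq , inj₂ (eq′ , _))) → ≤-reflexive (cong₂ (λ a b → a * n + b) eq eq′) }

    open Ranks refine-ranks

    refine-canonical : Canonical (value (refine A π))
    refine-canonical = canonical

    refine-< : ∀ p q → π p < π q → value (refine A π) p < value (refine A π) q
    refine-< p q lt = rank-< p q (code-mono (bounded (s p)) (inj₁ lt))

    refine-≡⁺ : ∀ p q → π p ≡ π q → π (s p) ≡ π (s q) → value (refine A π) p ≡ value (refine A π) q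
    refine-≡⁺ p q eq eq′ = rank-≡ p q (cong₂ (λ a b → a * n + b) eq eq′)

    -- Distinct codes are comparable and hence get distinct labels, so equal labels force equal
    -- codes, which can be decoded.
    refine-≡⁻ : ∀ p q → value (refine A π) p ≡ value (refine A π) q → π p ≡ π q × π (s p) ≡ π (s q)
    refine-≡⁻ p q eq with <-cmp (code p) (code q)
    ... | tri< lt _ _ = contradiction eq (<⇒≢ (rank-< p q lt))
    ... | tri≈ _ e _  = code-injective (bounded (s p)) (bounded (s q)) e
    ... | tri> _ _ gt = contradiction (sym eq) (<⇒≢ (rank-< q p gt))

-- Finite sums

∑ : List X → (X → ℕ) → ℕ
∑ xs f = sum (map f xs)

∑-cong : ∀ (xs : List X) {f g : X → ℕ} → (∀ x → f x ≡ g x) → ∑ xs f ≡ ∑ xs g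
∑-cong xs eq = cong sum (map-cong eq xs)

∑-mono : ∀ (xs : List X) {f g : X → ℕ} → (∀ x → f x ≤ g x) → ∑ xs f ≤ ∑ xs g
∑-mono []       le = z≤n
∑-mono (x ∷ xs) le = +-mono-≤ (le x) (∑-mono xs le)

∑-const : ∀ (xs : List X) c → ∑ xs (λ _ → c) ≡ length xs * c
∑-const []       c = refl
∑-const (x ∷ xs) c = cong (c +_) (∑-const xs c)

∑-+ : ∀ (xs : List X) (f g : X → ℕ) → ∑ xs (λ x → f x + g x) ≡ ∑ xs f + ∑ xs g
∑-+ []       f g = refl
∑-+ (x ∷ xs) f g = trans (cong (f x + g x +_) (∑-+ xs f g))
  (solve 4 (λ a b c d → a :+ b :+ (c :+ d) := a :+ c :+ (b :+ d)) refl (f x) (g x) (∑ xs f) (∑ xs g))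

∑-*ʳ : ∀ (xs : List X) (f : X → ℕ) c → ∑ xs f * c ≡ ∑ xs (λ x → f x * c)
∑-*ʳ []       f c = refl
∑-*ʳ (x ∷ xs) f c = trans (*-distribʳ-+ c (f x) _) (cong (f x * c +_) (∑-*ʳ xs f c))

∑-*ˡ : ∀ (xs : List X) (f : X → ℕ) c → c * ∑ xs f ≡ ∑ xs (λ x → c * f x)
∑-*ˡ xs f c = trans (*-comm c _) (trans (∑-*ʳ xs f c) (∑-cong xs (λ x → *-comm (f x) c)))

∑-++ : ∀ (xs ys : List X) (f : X → ℕ) → ∑ (xs ++ ys) f ≡ ∑ xs f + ∑ ys f
∑-++ xs ys f = trans (cong sum (map-++ f xs ys)) (sum-++ (map f xs) (map f ys))

∑-map : ∀ (xs : List X) (g : X → Y) (f : Y → ℕ) → ∑ (map g xs) f ≡ ∑ xs (f ∘ g)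
∑-map xs g f = cong sum (sym (map-∘ xs))

∑-swap : ∀ (xs : List X) (ys : List Y) (f : X → Y → ℕ) →
         ∑ xs (λ x → ∑ ys (f x)) ≡ ∑ ys (λ y → ∑ xs (λ x → f x y))
∑-swap []       ys f = sym (trans (∑-const ys 0) (*-zeroʳ (length ys)))
∑-swap (x ∷ xs) ys f = trans (cong (∑ ys (f x) +_) (∑-swap xs ys f)) (sym (∑-+ ys (f x) _))

∑-cartesianProductWith : ∀ (g : X → Y → Z) xs ys (f : Z → ℕ) →
                         ∑ (cartesianProductWith g xs ys) f ≡ ∑ xs (λ x → ∑ ys (λ y → f (g x y)))
∑-cartesianProductWith g []       ys f = refl
∑-cartesianProductWith g (x ∷ xs) ys f = trans (∑-++ (map (g x) ys) _ f)
  (cong₂ _+_ (∑-map ys (g x) f) (∑-cartesianProductWith g xs ys f))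

∑-∈ : ∀ {xs : List X} {x} (f : X → ℕ) → x ∈ xs → f x ≤ ∑ xs f
∑-∈ f (here refl) = m≤m+n _ _
∑-∈ f (there m)   = ≤-trans (∑-∈ f m) (m≤n+m _ _)

-- Provides constructively the case distinction whether any set `F` has its first difference at a
-- given step.
∑-zero-or : ∀ (xs : List X) (f : X → ℕ) → ∑ xs f ≡ 0 ⊎ ∃[ x ] f x ≢ 0
∑-zero-or []       f = inj₁ refl
∑-zero-or (x ∷ xs) f with f x in eq
... | suc _ = inj₂ (x , λ e → contradiction (trans (sym eq) e) λ ())
... | zero  = ∑-zero-or xs f

-- Counting subsets

⟦_⟧ : Bool → ℕ
⟦ b ⟧ = if b then 1 else 0

length-subsets : ∀ n → length (subsets n) ≡ 2 ^ n
length-subsets zero    = refl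
length-subsets (suc n) = trans (length-++ (map (true ∷_) (subsets n)))
  (cong₂ _+_ (trans (length-map _ (subsets n)) (length-subsets n))
             (trans (length-map _ (subsets n)) (trans (length-subsets n) (sym (+-identityʳ _)))))

∈-subsets : ∀ (F : Subset n) → F ∈ subsets n
∈-subsets []          = here refl
∈-subsets (true  ∷ F) = ∈-++⁺ˡ (∈-map⁺ (true ∷_) (∈-subsets F))
∈-subsets {suc n} (false ∷ F) = ∈-++⁺ʳ (map (true ∷_) (subsets n)) (∈-map⁺ (false ∷_) (∈-subsets F))

infixl 6 _⊕_
-- Symmetric difference, the addition of the vector space (ℤ/2)ⁿ.
_⊕_ : Subset n → Subset n → Subset n
_⊕_ = zipWith _xor_

∑-subsets-suc : ∀ n (f : Subset (suc n) → ℕ) →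
                ∑ (subsets (suc n)) f ≡ ∑ (subsets n) (f ∘ (true ∷_)) + ∑ (subsets n) (f ∘ (false ∷_))
∑-subsets-suc n f = trans (∑-++ (map (true ∷_) (subsets n)) _ f)
  (cong₂ _+_ (∑-map (subsets n) _ f) (∑-map (subsets n) _ f))

-- Translation by `G` permutes the subsets: a component `true` swaps the two halves of the list, a
-- component `false` keeps them.
∑-⊕ : ∀ (G : Subset n) (f : Subset n → ℕ) → ∑ (subsets n) (λ F → f (G ⊕ F)) ≡ ∑ (subsets n) f
∑-⊕ []          f = refl
∑-⊕ {suc n} (true ∷ G) f = begin
  ∑ (subsets (suc n)) (λ F → f ((true ∷ G) ⊕ F))
    ≡⟨ ∑-subsets-suc n _ ⟩
  ∑ (subsets n) (λ F → f (false ∷ (G ⊕ F))) + ∑ (subsets n) (λ F → f (true ∷ (G ⊕ F)))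
    ≡⟨ cong₂ _+_ (∑-⊕ G (f ∘ (false ∷_))) (∑-⊕ G (f ∘ (true ∷_))) ⟩
  ∑ (subsets n) (f ∘ (false ∷_)) + ∑ (subsets n) (f ∘ (true ∷_))
    ≡⟨ +-comm (∑ (subsets n) (f ∘ (false ∷_))) _ ⟩
  ∑ (subsets n) (f ∘ (true ∷_)) + ∑ (subsets n) (f ∘ (false ∷_))
    ≡⟨ sym (∑-subsets-suc n f) ⟩
  ∑ (subsets (suc n)) f ∎
  where open ≡-Reasoning
∑-⊕ {suc n} (false ∷ G) f = begin
  ∑ (subsets (suc n)) (λ F → f ((false ∷ G) ⊕ F))
    ≡⟨ ∑-subsets-suc n _ ⟩
  ∑ (subsets n) (λ F → f (true ∷ (G ⊕ F))) + ∑ (subsets n) (λ F → f (false ∷ (G ⊕ F)))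
    ≡⟨ cong₂ _+_ (∑-⊕ G (f ∘ (true ∷_))) (∑-⊕ G (f ∘ (false ∷_))) ⟩
  ∑ (subsets n) (f ∘ (true ∷_)) + ∑ (subsets n) (f ∘ (false ∷_))
    ≡⟨ sym (∑-subsets-suc n f) ⟩
  ∑ (subsets (suc n)) f ∎
  where open ≡-Reasoning

-- The sum of `f` is taken twice, once along `F` and once along its translate, and the two are
-- paired termwise.
∑-halve : ∀ (G : Subset n) (f g : Subset n → ℕ) → (∀ F → f F + f (G ⊕ F) ≡ g F) →
          ∑ (subsets n) f * 2 ≡ ∑ (subsets n) g
∑-halve {n} G f g eq = begin
  a * 2                                      ≡⟨ solve 1 (λ a → a :* con 2 := a :+ a) refl a ⟩
  a + a                                      ≡⟨ cong (a +_) (sym (∑-⊕ G f)) ⟩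
  a + ∑ (subsets n) (λ F → f (G ⊕ F))        ≡⟨ sym (∑-+ (subsets n) f _) ⟩
  ∑ (subsets n) (λ F → f F + f (G ⊕ F))      ≡⟨ ∑-cong (subsets n) eq ⟩
  ∑ (subsets n) g                            ∎
  where
  open ≡-Reasoning
  a = ∑ (subsets n) f

count-differ : ∀ {a b : Fin n} → a ≢ b → ∑ (subsets n) (λ F → ⟦ lookup F a xor lookup F b ⟧) * 2 ≡ 2 ^ n
count-differ {n} {a} {b} a≢b = begin
  ∑ (subsets n) (λ F → ⟦ lookup F a xor lookup F b ⟧) * 2 ≡⟨ ∑-halve G _ (λ _ → 1) flip-a ⟩
  ∑ (subsets n) (λ _ → 1) ≡⟨ ∑-const (subsets n) 1 ⟩
  length (subsets n) * 1 ≡⟨ *-identityʳ _ ⟩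
  length (subsets n) ≡⟨ length-subsets n ⟩
  2 ^ n ∎
  where
  open ≡-Reasoning
  -- Translation by the singleton of `a` toggles membership of `a` only, and so exchanges the sets
  -- that separate `a` from `b` with those that do not.
  G = Vec.replicate n false Vec.[ a ]≔ true
  flip-a : ∀ F → ⟦ lookup F a xor lookup F b ⟧ + ⟦ lookup (G ⊕ F) a xor lookup (G ⊕ F) b ⟧ ≡ 1
  flip-a F rewrite lookup-zipWith _xor_ a G F | lookup-zipWith _xor_ b G F
    | lookup∘update a (Vec.replicate n false) true
    | lookup∘update′ (a≢b ∘ sym) (Vec.replicate n false) true | lookup-replicate b false
    with lookup F a | lookup F b
  ... | true  | true  = refl
  ... | true  | false = refl
  ... | false | true  = refl
  ... | false | false = refl

-- First differences

-- For a single pair of states, d F j says whether F separates them after j steps.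
module FirstDifference (d : Subset n → ℕ → Bool)
  (linear : ∀ G F j → d (G ⊕ F) j ≡ d G j xor d F j)
  (shift : ∀ F m → ∃[ G ] ∀ j → d G j ≡ d F (j + m)) where

  -- The indicator of the subspace E k.
  agree : ℕ → Subset n → Bool
  agree zero    F = true
  agree (suc k) F = agree k F ∧ not (d F k)

  first : ℕ → Subset n → Bool
  first l F = agree l F ∧ d F l

  agree⁺ : ∀ k F → (∀ j → j < k → d F j ≡ false) → agree k F ≡ true
  agree⁺ zero    F h = refl
  agree⁺ (suc k) F h rewrite h k ≤-refl | agree⁺ k F (λ j j<k → h j (m<n⇒m<1+n j<k)) = refl

  agree⁻ : ∀ k F → agree k F ≡ true → ∀ j → j < k → d F j ≡ false
  agree⁻ (suc k) F eq j (s≤s j≤k) with agree k F in eq′ | d F k in eq″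
  ... | true | false with m≤n⇒m<n∨m≡n j≤k
  ...   | inj₁ j<k  = agree⁻ k F eq′ j j<k
  ...   | inj₂ refl = eq″

  module _ {l} {F₀ : Subset n} (before : ∀ j → j < l → d F₀ j ≡ false) (at : d F₀ l ≡ true) where

    -- Adding the translate of F₀ whose first difference is at k exchanges the
    -- two halves of agree k.
    halve : ∀ k → k ≤ l → ∑ (subsets n) (λ F → ⟦ agree (suc k) F ⟧) * 2 ≡ ∑ (subsets n) (λ F → ⟦ agree k F ⟧)
    halve k k≤l with shift F₀ (l ∸ k)
    ... | G , shifted = ∑-halve G _ _ exchange
      where
      G-before : ∀ j → j < k → d G j ≡ false
      G-before j j<k = trans (shifted j) (before _ (subst (j + (l ∸ k) <_) (m+[n∸m]≡n k≤l) (+-monoˡ-< (l ∸ k) j<k)))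

      G-at : d G k ≡ true
      G-at = trans (shifted k) (trans (cong (d F₀) (m+[n∸m]≡n k≤l)) at)

      same-agree : ∀ F m → m ≤ k → agree m (G ⊕ F) ≡ agree m F
      same-agree F zero    _   = refl
      same-agree F (suc m) m<k rewrite same-agree F m (<⇒≤ m<k) | linear G F m | G-before m m<k = refl

      exchange : ∀ F → ⟦ agree (suc k) F ⟧ + ⟦ agree (suc k) (G ⊕ F) ⟧ ≡ ⟦ agree k F ⟧
      exchange F rewrite same-agree F k ≤-refl | linear G F k | G-at with agree k F | d F k
      ... | true  | true  = refl
      ... | true  | false = refl
      ... | false | _     = refl

    count-agree : ∀ k → k ≤ l → ∑ (subsets n) (λ F → ⟦ agree k F ⟧) * 2 ^ k ≡ 2 ^ n
    count-agree zero    _   = trans (*-identityʳ _) (trans (∑-const (subsets n) 1) (trans (*-identityʳ _) (length-subsets n)))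
    count-agree (suc k) k<l = begin
      a * (2 * 2 ^ k)                                      ≡⟨ sym (*-assoc a 2 (2 ^ k)) ⟩
      a * 2 * 2 ^ k                                        ≡⟨ cong (_* 2 ^ k) (halve k (<⇒≤ k<l)) ⟩
      ∑ (subsets n) (λ F → ⟦ agree k F ⟧) * 2 ^ k          ≡⟨ count-agree k (<⇒≤ k<l) ⟩
      2 ^ n                                                ∎
      where
      open ≡-Reasoning
      a = ∑ (subsets n) (λ F → ⟦ agree (suc k) F ⟧)

    -- E l contains `F₀`, and its size times `2 ^ l` is `2 ^ n`.
    first-≤ : l ≤ n
    first-≤ = ≮⇒≥ λ n<l → <⇒≱ (^-monoʳ-< 2 (s≤s (s≤s z≤n)) n<l) (begin
      2 ^ l     ≡⟨ sym (*-identityˡ _) ⟩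
      1 * 2 ^ l ≤⟨ *-monoˡ-≤ (2 ^ l) (≤-trans (≤-reflexive (cong ⟦_⟧ (sym (agree⁺ l F₀ before)))) (∑-∈ _ (∈-subsets F₀))) ⟩
      ∑ (subsets n) (λ F → ⟦ agree l F ⟧) * 2 ^ l ≡⟨ count-agree l ≤-refl ⟩
      2 ^ n     ∎)
      where open ≤-Reasoning

  -- Either no set has its first difference at `l`, or one such set makes all the halvings up to `l`
  -- available; then the size of E l is an upper bound.
  count-first : ∀ l → ∑ (subsets n) (λ F → ⟦ first l F ⟧) * 2 ^ l ≤ 2 ^ n
  count-first l with ∑-zero-or (subsets n) (λ F → ⟦ first l F ⟧)
  ... | inj₁ eq rewrite eq = z≤n
  ... | inj₂ (F₀ , ne) with agree l F₀ in eq | d F₀ l in eq′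
  ... | false | _     = contradiction refl ne
  ... | true  | false = contradiction refl ne
  ... | true  | true  = ≤-trans (*-monoˡ-≤ (2 ^ l) (∑-mono (subsets n) weaken))
                          (≤-reflexive (count-agree (agree⁻ l F₀ eq) eq′ l ≤-refl))
    where
    weaken : ∀ F → ⟦ first l F ⟧ ≤ ⟦ agree l F ⟧
    weaken F with agree l F | d F l
    ... | true  | true  = ≤-refl
    ... | true  | false = z≤n
    ... | false | _     = ≤-refl

-- Orbits and separation of states

orbit : (X → X) → ℕ → X → X
orbit s zero    p = p
orbit s (suc j) p = orbit s j (s p)

orbit-+ : ∀ (s : X → X) j m p → orbit s m (orbit s j p) ≡ orbit s (j + m) p
orbit-+ s zero    m p = refl
orbit-+ s (suc j) m p = orbit-+ s j m (s p)

separates : (Fin n → Fin n) → Fin n → Fin n → Subset n → ℕ → Bool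
separates s p q F j = lookup F (orbit s j p) xor lookup F (orbit s j q)

separates-⊕ : ∀ (s : Fin n → Fin n) p q G F j → separates s p q (G ⊕ F) j ≡ separates s p q G j xor separates s p q F j
separates-⊕ s p q G F j rewrite lookup-zipWith _xor_ (orbit s j p) G F | lookup-zipWith _xor_ (orbit s j q) G F
  with lookup G (orbit s j p) | lookup G (orbit s j q) | lookup F (orbit s j p) | lookup F (orbit s j q)
... | true  | true  | true  | true  = refl
... | true  | true  | true  | false = refl
... | true  | true  | false | true  = refl
... | true  | true  | false | false = refl
... | true  | false | true  | true  = refl
... | true  | false | true  | false = refl
... | true  | false | false | true  = refl
... | true  | false | false | false = refl
... | false | true  | true  | true  = refl
... | false | true  | true  | false = refl
... | false | true  | false | true  = refl
... | false | true  | false | false = refl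
... | false | false | _     | _     = refl

-- The translate of `F` is its preimage under the `m`-th iterate of `s`.
separates-shift : ∀ (s : Fin n → Fin n) p q F m → ∃[ G ] ∀ j → separates s p q G j ≡ separates s p q F (j + m)
separates-shift s p q F m = Vec.tabulate (λ p → lookup F (orbit s m p)) , λ j → cong₂ _xor_ (shifted p j) (shifted q j)
  where
  shifted : ∀ p j → lookup (Vec.tabulate (λ p → lookup F (orbit s m p))) (orbit s j p) ≡ lookup F (orbit s (j + m) p)
  shifted p j = trans (lookup∘tabulate _ (orbit s j p)) (cong (lookup F) (orbit-+ s j m p))

module Difference {n} (s : Fin n → Fin n) (p q : Fin n) =
  FirstDifference (separates s p q) (separates-⊕ s p q) (separates-shift s p q)

xor-false⇒≡ : ∀ {a b} → a xor b ≡ false → a ≡ b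
xor-false⇒≡ {true}  {true}  _ = refl
xor-false⇒≡ {false} {false} _ = refl

-- Runs of Moore's algorithm

Agree : Automaton 1 n → ℕ → Fin n → Fin n → Set
Agree A k p q = ∀ j → j < k → separates (λ p → δ A p zero) p q (F A) j ≡ false

-- `rounds` is the number ρ of rounds that change the partition; when the main loop is entered, one
-- last round without change follows them. By `changed`, every step from 1 to ρ is the first
-- separation time of some pair.
record Run (A : Automaton 1 n) : Set where
  s : Fin n → Fin n
  s p = δ A p zero

  field
    time        : ℕ
    rounds      : ℕ
    runningTime : RunningTime A time
    -- The summand 3 is paid for by the test for finality. It absorbs the additive constant in the
    -- lower bound on `rounds`.
    lower       : n * (rounds + 3) ≤ time
    upper       : time ≤ 139 * n * suc rounds
    changed     : ∀ m → m < rounds → ∃[ p ] ∃[ q ] Agree A (suc m) p q × separates s p q (F A) (suc m) ≡ true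
    stable      : ∀ p q → Agree A (suc rounds) p q → ∀ j → separates s p q (F A) j ≡ false

  -- The last round with a change exhibits a pair first separated at step `rounds`, and first
  -- separation times are at most `n`.
  rounds-≤ : rounds ≤ n
  rounds-≤ = bound rounds changed
    where
    bound : ∀ ρ → (∀ m → m < ρ → ∃[ p ] ∃[ q ] Agree A (suc m) p q × separates s p q (F A) (suc m) ≡ true) → ρ ≤ n
    bound zero    _  = z≤n
    bound (suc m) ch with p , q , agree , differ ← ch m ≤-refl = Difference.first-≤ s p q {F₀ = F A} agree differ

module _ (A : Automaton 1 n) where
  open Refine A

  n≥1 : 1 ≤ n
  n≥1 = inhabited (q₀ A)
    where
    inhabited : ∀ {m} → Fin m → 1 ≤ m
    inhabited zero    = s≤s z≤n
    inhabited (suc _) = s≤s z≤n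

  finality-loop : ∀ s₀ ps → let r = value (forEach ps s₀ λ (none , all) p → isFinal A p >>= λ x → op (none ∧ not x) >>= λ none′ →
                                         op (all ∧ x) >>= λ all′ → return (none′ , all′)) in
                  proj₁ r ≡ foldl (λ b p → b ∧ not (lookup (F A) p)) (proj₁ s₀) ps ×
                  proj₂ r ≡ foldl (λ b p → b ∧ lookup (F A) p) (proj₂ s₀) ps
  finality-loop s₀ []       = refl , refl
  finality-loop s₀ (p ∷ ps) = finality-loop _ ps

  finality-none : proj₁ (value (finality A)) ≡ foldl (λ b p → b ∧ not (lookup (F A) p)) true (states A)
  finality-none = proj₁ (finality-loop (true , true) (states A))

  finality-all : proj₂ (value (finality A)) ≡ foldl (λ b p → b ∧ lookup (F A) p) true (states A)
  finality-all = proj₂ (finality-loop (true , true) (states A))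

  constant-run : ∀ b → Moore A (finality A >>= λ _ → singleton A b) → (∀ p q → lookup (F A) p ≡ lookup (F A) q) → Run A
  constant-run b moore constant = record
    { time        = cost (finality A) + 6
    ; rounds      = 0
    ; runningTime = _ , moore , refl
    ; lower       = ≤-trans (m≤n⇒m≤1+n (*-monoʳ-≤ n (m≤m+n 3 1)))
                      (≤-trans (≤-reflexive (sym finality-cost)) (m≤m+n _ 6))
    ; upper       = begin
        cost (finality A) + 6  ≡⟨ cong (_+ 6) finality-cost ⟩
        1 + n * 4 + 6          ≤⟨ +-mono-≤ (+-monoˡ-≤ (n * 4) n≥1) (*-monoʳ-≤ 6 n≥1) ⟩
        n + n * 4 + 6 * n      ≡⟨ solve 1 (λ n → n :+ n :* con 4 :+ con 6 :* n := con 11 :* n) refl n ⟩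
        11 * n                 ≤⟨ *-monoˡ-≤ n (m≤m+n 11 128) ⟩
        139 * n                ≡⟨ sym (*-identityʳ _) ⟩
        139 * n * 1            ∎
    ; changed     = λ _ ()
    ; stable      = λ p q _ j → trans (cong (_xor lookup (F A) (orbit s j q)) (constant (orbit s j p) (orbit s j q))) (Boolₚ.xor-same (lookup (F A) (orbit s j q)))
    }
    where open ≤-Reasoning

  π : ℕ → Labels n
  π zero    = value (initial A)
  π (suc m) = value (refine A (π m))

  test : ℕ → Bool
  test m = value (different A (just (π m) , π (suc m)))

  -- Describes the loop entered with `π j` and `π (suc j)`: `j + count` is the first index from `j`
  -- on at which refining leaves the labels unchanged.
  record Loop (j : ℕ) : Set where
    field
      count   : ℕ
      result  : Time (LoopState A)
      loops   : While (different A) (round A) (just (π j) , π (suc j)) result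
      lower   : count * n ≤ cost result
      upper   : cost result ≤ suc count * (49 * n + 11)
      changes : ∀ i → i < count → test (j + i) ≡ true
      ends    : test (j + count) ≡ false

  round-upper : ∀ x m → cost (round A (x , π m)) ≤ 44 * n + 9
  round-upper x m = begin
    1 + (cost (refine A (π m)) + 0) ≡⟨ cong suc (+-identityʳ _) ⟩
    1 + cost (refine A (π m))       ≤⟨ +-monoʳ-≤ 1 (refine-cost (π m)) ⟩
    1 + (44 * n + 8)                ≡⟨ +-comm 1 (44 * n + 8) ⟩
    44 * n + 8 + 1                  ≡⟨ +-assoc (44 * n) 8 1 ⟩
    44 * n + 9                      ∎
    where open ≤-Reasoning

  round-lower : ∀ x m → n ≤ cost (round A (x , π m))
  round-lower x m = ≤-trans (refine-cost-lower (π m)) (≤-trans (m≤m+n _ 0) (n≤1+n _))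

  -- `d` serves as fuel: the test is known to fail at `j + d`, and the recursion stops at the first
  -- failure, possibly earlier.
  loop : ∀ d j → test (j + d) ≡ false → Loop j
  loop d j end with test j in eq
  ... | false = record
    { count = 0
    ; result = _
    ; loops = exit eq
    ; lower = z≤n
    ; upper = ≤-trans (≤-reflexive (different-cost (π j) (π (suc j)))) (begin
        2 + n * 5          ≡⟨ trans (+-comm 2 (n * 5)) (cong (_+ 2) (*-comm n 5)) ⟩
        5 * n + 2          ≤⟨ +-mono-≤ (*-monoˡ-≤ n (m≤m+n 5 44)) (m≤m+n 2 9) ⟩
        49 * n + 11        ≡⟨ sym (+-identityʳ _) ⟩
        49 * n + 11 + 0    ∎)
    ; changes = λ _ ()
    ; ends = trans (cong test (+-identityʳ j)) eq
    }
    where open ≤-Reasoning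
  loop zero j end | true = contradiction (trans (sym eq) (trans (cong test (sym (+-identityʳ j))) end)) λ ()
  loop (suc d) j end | true = record
    { count = suc L.count
    ; result = _
    ; loops = iterate eq L.loops
    ; lower = ≤-trans (+-mono-≤ (round-lower (just (π j)) (suc j)) L.lower) (m≤n+m _ _)
    ; upper = begin
        cost (different A (just (π j) , π (suc j))) + (cost (round A (just (π j) , π (suc j))) + cost L.result)
          ≤⟨ +-mono-≤ (≤-reflexive (different-cost (π j) (π (suc j)))) (+-mono-≤ (round-upper (just (π j)) (suc j)) L.upper) ⟩
        2 + n * 5 + (44 * n + 9 + suc L.count * (49 * n + 11))
          ≡⟨ solve 2 (λ n c → con 2 :+ n :* con 5 :+ (con 44 :* n :+ con 9 :+ c) := con 49 :* n :+ con 11 :+ c) refl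
               n (suc L.count * (49 * n + 11)) ⟩
        49 * n + 11 + suc L.count * (49 * n + 11) ∎
    ; changes = λ { zero _ → trans (cong test (+-identityʳ j)) eq
                  ; (suc i) (s≤s i<) → trans (cong test (+-suc j i)) (L.changes i i<) }
    ; ends = trans (cong test (+-suc j L.count)) L.ends
    }
    where
    open ≤-Reasoning
    module L = Loop (loop d (suc j) (trans (cong test (sym (+-suc j d))) end))

  module _ {p₊ p₋ : Fin n} (final : lookup (F A) p₊ ≡ true) (nonfinal : lookup (F A) p₋ ≡ false) where

    -- Initially both labels 0 and 1 are in use, because there are a nonfinal and a final state.
    -- Afterwards every refinement numbers the classes without gaps.
    π-canonical : ∀ m → Canonical (π m)
    π-canonical zero p zero c≤ = p₋ , trans (initial-value p₋) (cong (λ b → if b then 1 else 0) nonfinal)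
    π-canonical zero p (suc zero) c≤ = p₊ , trans (initial-value p₊) (cong (λ b → if b then 1 else 0) final)
    π-canonical zero p (suc (suc c)) c≤ rewrite initial-value p with lookup (F A) p
    π-canonical zero p (suc (suc c)) (s≤s ()) | true
    π-canonical (suc m) = refine-canonical (π m) (canonical⇒bounded (π-canonical m))

    bounded : ∀ m → Bounded (π m)
    bounded m = canonical⇒bounded (π-canonical m)

    -- With its converse `agree⇒π`, this identifies `π m` with Moore equivalence: the old label
    -- records the steps up to `m`, and the label of the successor adds step `suc m`.
    π⇒agree : ∀ m p q → π m p ≡ π m q → Agree A (suc m) p q
    π⇒agree zero p q eq zero _ = equal (trans (sym (initial-value p)) (trans eq (initial-value q)))
      where
      equal : ∀ {a b} → (if a then 1 else 0) ≡ (if b then 1 else 0) → a xor b ≡ false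
      equal {true}  {true}  _ = refl
      equal {false} {false} _ = refl
    π⇒agree zero p q eq (suc j) (s≤s ())
    π⇒agree (suc m) p q eq zero _ = π⇒agree m p q (proj₁ (refine-≡⁻ (π m) (bounded m) p q eq)) zero (s≤s z≤n)
    π⇒agree (suc m) p q eq (suc j) (s≤s j<) =
      π⇒agree m (s p) (s q) (proj₂ (refine-≡⁻ (π m) (bounded m) p q eq)) j j<

    agree⇒π : ∀ m p q → Agree A (suc m) p q → π m p ≡ π m q
    agree⇒π zero p q agree = trans (initial-value p)
      (trans (cong (λ b → if b then 1 else 0) (xor-false⇒≡ (agree 0 (s≤s z≤n)))) (sym (initial-value q)))
    agree⇒π (suc m) p q agree = refine-≡⁺ (π m) (bounded m) p q
      (agree⇒π m p q (λ j j< → agree j (m<n⇒m<1+n j<)))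
      (agree⇒π m (s p) (s q) (λ j j< → agree (suc j) (s≤s j<)))

    -- If refining changes nothing, agreement up to step `m` implies agreement up to step `suc m`.
    -- It is thus inherited by the successors, and induction on `j` applies.
    π-stable : ∀ m → test m ≡ false → ∀ p q → Agree A (suc m) p q → ∀ j → separates s p q (F A) j ≡ false
    π-stable m end p q agree zero    = agree 0 (s≤s z≤n)
    π-stable m end p q agree (suc j) = π-stable m end (s p) (s q) (λ i i< → agree′ (suc i) (s≤s i<)) j
      where
      same : ∀ p → π m p ≡ π (suc m) p
      same = different-false⇒≡ (π m) (π (suc m)) end
      agree′ : Agree A (suc (suc m)) p q
      agree′ = π⇒agree (suc m) p q (trans (sym (same p)) (trans (agree⇒π m p q agree) (same q)))

    π-changed : ∀ m → test m ≡ true → ∃[ p ] ∃[ q ] Agree A (suc m) p q × separates s p q (F A) (suc m) ≡ true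
    -- Searches for a pair that the refinement splits. Without one, the old and new labellings are
    -- canonical with the same classes in the same order, hence equal.
    π-changed m cont with any? (λ p → any? (λ q → (π m p ≟ π m q) ×-dec ¬? (π (suc m) p ≟ π (suc m) q)))
    ... | no none = contradiction (trans (sym cont) (≡⇒different-false (π m) (π (suc m))
        (canonical-unique (π-canonical m) (π-canonical (suc m))
          (λ p q eq → decidable-stable (π (suc m) p ≟ π (suc m) q) λ ne → none (p , q , eq , ne))
          (refine-< (π m) (bounded m))))) λ ()
    -- The old labels give agreement up to step `m`; agreement at step `suc m` as well would make
    -- the new labels equal.
    ... | yes (p , q , eq , ne) = p , q , agree , Boolₚ.¬-not λ same → ne (agree⇒π (suc m) p q (extend same))
      where
      agree = π⇒agree m p q eq
      extend : separates s p q (F A) (suc m) ≡ false → Agree A (suc (suc m)) p q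
      extend same j (s≤s j≤) with m≤n⇒m<n∨m≡n j≤
      ... | inj₁ j<   = agree j j<
      ... | inj₂ refl = same

    -- A change at index `n` would give a first separation at step `suc n`, beyond the bound
    -- `first-≤`.
    π-terminates : test n ≡ false
    π-terminates with test n in eq
    ... | false = refl
    ... | true with p , q , agree , differ ← π-changed n eq =
      contradiction (Difference.first-≤ s p q {F₀ = F A} agree differ) (<⇒≱ ≤-refl)

    proper-run : proj₁ (value (finality A)) ≡ false → proj₂ (value (finality A)) ≡ false → Run A
    proper-run none all = record
      { time        = _
      ; rounds      = L.count
      -- The first iteration is unconditional, since the previous partition is undefined.
      ; runningTime = _ , F-proper none all (iterate refl L.loops) , refl
      ; lower       = begin
          n * (L.count + 3)                   ≡⟨ solve 2 (λ n c → n :* (c :+ con 3) := n :* con 3 :+ c :* n) refl n L.count ⟩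
          n * 3 + L.count * n                 ≤⟨ +-mono-≤ (m≤n⇒m≤1+n (*-monoʳ-≤ n (m≤m+n 3 1))) L.lower ⟩
          1 + n * 4 + cost L.result           ≡⟨ cong (_+ cost L.result) (sym finality-cost) ⟩
          cost (finality A) + cost L.result   ≤⟨ +-monoʳ-≤ (cost (finality A)) (≤-trans (m≤n+m _ (1 + cost (round A (nothing , π 0))))
                                                   (≤-trans (m≤m+n _ _) (m≤n+m _ (cost (initial A))))) ⟩
          total                               ∎
      ; upper       = begin
          total
            ≤⟨ +-mono-≤ (≤-reflexive finality-cost) (+-mono-≤ (≤-reflexive initial-cost)
                 (+-mono-≤ (+-monoʳ-≤ 1 (+-mono-≤ (round-upper nothing 0) L.upper)) (≤-reflexive (quotient-cost _)))) ⟩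
          1 + n * 4 + (n + (1 + n * 4) + (1 + (44 * n + 9 + k * (49 * n + 11)) + (n + (n + (1 + (1 + n * 10))))))
            ≡⟨ solve 2 (λ n x → con 1 :+ n :* con 4 :+ (n :+ (con 1 :+ n :* con 4) :+ (con 1 :+ (con 44 :* n :+ con 9 :+ x)
                   :+ (n :+ (n :+ (con 1 :+ (con 1 :+ n :* con 10)))))) := con 65 :* n :+ con 14 :+ x) refl n (k * (49 * n + 11)) ⟩
          -- As `k ≥ 1`, the work outside the counted iterations may be multiplied by `k`; as
          -- `n ≥ 1`, the constants become multiples of `n`. This gives 139 = 65 + 49 + 14 + 11.
          65 * n + 14 + k * (49 * n + 11)
            ≤⟨ +-monoˡ-≤ (k * (49 * n + 11)) (m≤n*m (65 * n + 14) k) ⟩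
          k * (65 * n + 14) + k * (49 * n + 11)
            ≡⟨ solve 2 (λ n k → k :* (con 65 :* n :+ con 14) :+ k :* (con 49 :* n :+ con 11) := (con 114 :* n :+ con 25 :* con 1) :* k) refl n k ⟩
          (114 * n + 25 * 1) * k
            ≤⟨ *-monoˡ-≤ k (+-monoʳ-≤ (114 * n) (*-monoʳ-≤ 25 n≥1)) ⟩
          (114 * n + 25 * n) * k
            ≡⟨ cong (_* k) (sym (*-distribʳ-+ n 114 25)) ⟩
          139 * n * k ∎
      ; changed     = λ m m< → π-changed m (L.changes m m<)
      ; stable      = π-stable L.count L.ends
      }
      where
      open ≤-Reasoning
      module L = Loop (loop n 0 π-terminates)
      k = suc L.count
      total = cost (finality A) + (cost (initial A) + (1 + (cost (round A (nothing , π 0)) + cost L.result)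
                + cost (quotient A (proj₂ (value L.result)))))

  run : Run A
  run with proj₁ (value (finality A)) in none | proj₂ (value (finality A)) in all
  ... | true | _ = constant-run false (F-empty none) λ p q → trans (all-nonfinal p) (sym (all-nonfinal q))
    where
    all-nonfinal : ∀ p → lookup (F A) p ≡ false
    all-nonfinal p = trans (sym (Boolₚ.not-involutive _)) (cong not
      (proj₂ (and-loop _ true (states A) (trans (sym finality-none) none)) (∈-allFin p)))
  ... | false | true = constant-run true (F-full none all) λ p q → trans (all-final p) (sym (all-final q))
    where
    all-final : ∀ p → lookup (F A) p ≡ true
    all-final p = proj₂ (and-loop _ true (states A) (trans (sym finality-all) all)) (∈-allFin p)
  ... | false | false with any? (λ p → lookup (F A) p Boolₚ.≟ true) | any? (λ p → lookup (F A) p Boolₚ.≟ false)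
  ... | yes (_ , final) | yes (_ , nonfinal) = proper-run final nonfinal none all
  ... | no ¬final | _ = contradiction (trans (sym none) (trans finality-none
        (and-loop-true _ (λ p → cong not (Boolₚ.¬-not (λ eq → ¬final (p , eq)))) (states A)))) λ ()
  ... | yes _ | no ¬nonfinal = contradiction (trans (sym all) (trans finality-all
        (and-loop-true _ (λ p → Boolₚ.¬-not (λ eq → ¬nonfinal (p , eq))) (states A)))) λ ()

-- Boolean words, periods and logarithms

digit : Bool → Fin 2
digit false = zero
digit true  = suc zero

digit-injective : ∀ {a b} → digit a ≡ digit b → a ≡ b
digit-injective {false} {false} _ = refl
digit-injective {true}  {true}  _ = refl

-- The first `k` values read as a binary numeral, so that the pigeonhole principle for `Fin` applies
-- to words.
encode : ∀ k → (ℕ → Bool) → Fin (2 ^ k)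
encode zero    f = zero
encode (suc k) f = combine (digit (f 0)) (encode k (f ∘ suc))

encode-injective : ∀ k f g → encode k f ≡ encode k g → ∀ j → j < k → f j ≡ g j
encode-injective (suc k) f g eq j j<
  with combine-injective (digit (f 0)) (encode k (f ∘ suc)) (digit (g 0)) (encode k (g ∘ suc)) eq
encode-injective (suc k) f g eq zero    _        | eq₀ , _ = digit-injective eq₀
encode-injective (suc k) f g eq (suc j) (s≤s j<) | _ , eq₁ = encode-injective k _ _ eq₁ j j<

period-multiple : ∀ (x : ℕ → X) a d → (∀ i → a ≤ i → x i ≡ x (i + d)) → ∀ k i → a ≤ i → x i ≡ x (i + k * d)
period-multiple x a d period zero    i a≤i = cong x (sym (+-identityʳ i))
period-multiple x a d period (suc k) i a≤i = trans (period i a≤i)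
  (trans (period-multiple x a d period k (i + d) (≤-trans a≤i (m≤m+n i d))) (cong x (+-assoc i d (k * d))))

n<2^1+log : ∀ n → n < 2 ^ suc ⌊log₂ n ⌋
n<2^1+log n = ≰⇒> λ le → <⇒≱ ≤-refl (subst (_≤ ⌊log₂ n ⌋) (⌊log₂[2^n]⌋≡n (suc ⌊log₂ n ⌋)) (⌊log₂⌋-mono-≤ le))

n≤2^k⇒log≤k : ∀ n k → n ≤ 2 ^ k → ⌊log₂ n ⌋ ≤ k
n≤2^k⇒log≤k n k le = subst (⌊log₂ n ⌋ ≤_) (⌊log₂[2^n]⌋≡n k) (⌊log₂⌋-mono-≤ le)

-- The transition function of a unary automaton

next-< : ∀ {n} (t p : Fin n) → suc (toℕ p) < n → toℕ (next t p) ≡ suc (toℕ p)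
next-< {n} t p lt with suc (toℕ p) <? n
... | yes lt′ = toℕ-fromℕ< lt′
... | no ¬lt  = contradiction lt ¬lt

next-last : ∀ {n} (t p : Fin n) → suc (toℕ p) ≡ n → next t p ≡ t
next-last {n} t p eq with suc (toℕ p) <? n
... | yes lt = contradiction eq (<⇒≢ lt)
... | no _   = refl

orbit-suc : ∀ (s : X → X) i p → orbit s (suc i) p ≡ s (orbit s i p)
orbit-suc s i p = trans (cong (λ j → orbit s j p) (+-comm 1 i)) (sym (orbit-+ s i 1 p))

-- Upper bound for a fixed last transition

module _ {n : ℕ} (t : Fin (suc n)) where

  private
    s : Fin (suc n) → Fin (suc n)
    s = next t

    N = suc n
    L = ⌊log₂ N ⌋
    -- The cut-off is chosen such that N ^ 3 ≤ 2 ^ suc m.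
    m = 2 + L * 3

  runs : ∀ F → Run (unary t F)
  runs F = run (unary t F)

  time : Subset N → ℕ
  time F = Run.time (runs F)

  rounds : Subset N → ℕ
  rounds F = Run.rounds (runs F)

  toℕ-orbit : ∀ i → i ≤ n → toℕ (orbit s i zero) ≡ i
  toℕ-orbit zero    _   = refl
  toℕ-orbit (suc i) i<n = begin
    toℕ (orbit s (suc i) zero) ≡⟨ cong toℕ (orbit-suc s i zero) ⟩
    toℕ (s (orbit s i zero))   ≡⟨ next-< t (orbit s i zero) (s≤s (subst (_< n) (sym ih) i<n)) ⟩
    suc (toℕ (orbit s i zero)) ≡⟨ cong suc ih ⟩
    suc i                      ∎
    where
    open ≡-Reasoning
    ih = toℕ-orbit i (<⇒≤ i<n)

  orbit-state : ∀ p → orbit s (toℕ p) zero ≡ p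
  orbit-state p = toℕ-injective (toℕ-orbit (toℕ p) (≤-pred (toℕ<n p)))

  orbit-N : orbit s N zero ≡ t
  orbit-N = trans (orbit-suc s n zero) (next-last t _ (cong suc (toℕ-orbit n ≤-refl)))

  -- The number of ordered pairs first separated exactly at step `suc m`. If more than `m` rounds
  -- change the partition, such a pair exists, since `changed` applies to index `m`.
  late : Subset N → ℕ
  late F = ∑ (allFin N) λ p → ∑ (allFin N) λ q → ⟦ Difference.first s p q (suc m) F ⟧

  rounds-≤-late : ∀ F → rounds F ≤ m + late F * N
  rounds-≤-late F with rounds F ≤? m
  ... | yes le = ≤-trans le (m≤m+n m _)
  ... | no ¬le with p , q , agree , differ ← Run.changed (runs F) m (≰⇒> ¬le) = begin
      rounds F           ≤⟨ Run.rounds-≤ (runs F) ⟩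
      N                  ≡⟨ sym (*-identityˡ N) ⟩
      1 * N              ≡⟨ cong (λ b → ⟦ b ⟧ * N) (sym (cong₂ _∧_ (Difference.agree⁺ s p q (suc m) F agree) differ)) ⟩
      ⟦ Difference.first s p q (suc m) F ⟧ * N
        ≤⟨ *-monoˡ-≤ N (≤-trans (∑-∈ (λ q → ⟦ Difference.first s p q (suc m) F ⟧) (∈-allFin q))
                                (∑-∈ (λ p → ∑ (allFin N) λ q → ⟦ Difference.first s p q (suc m) F ⟧) (∈-allFin p))) ⟩
      late F * N         ≤⟨ m≤n+m _ m ⟩
      m + late F * N     ∎
    where open ≤-Reasoning

  ∑-allFin : ∀ (f : Fin N → ℕ) c → (∀ p → f p ≤ c) → ∑ (allFin N) f ≤ N * c
  ∑-allFin f c le = ≤-trans (∑-mono (allFin N) le)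
    (≤-reflexive (trans (∑-const (allFin N) c) (cong (_* c) (length-tabulate {n = N} (λ i → i)))))

  -- Union bound over `N * N` pairs, each late for at most a fraction 1 / `2 ^ suc m` of the sets.
  -- The further factor `N` is the worst-case number of rounds, so `N ^ 3 ≤ 2 ^ suc m` is what is
  -- needed.
  ∑-late : ∑ (subsets N) late * N ≤ 2 ^ N
  ∑-late = *-cancelʳ-≤ _ _ (2 ^ suc m) {{m^n≢0 2 (suc m)}} (begin
    ∑ (subsets N) late * N * 2 ^ suc m
      ≡⟨ trans (*-assoc (∑ (subsets N) late) N _) (trans (cong (∑ (subsets N) late *_) (*-comm N _)) (sym (*-assoc (∑ (subsets N) late) _ N))) ⟩
    ∑ (subsets N) late * 2 ^ suc m * N
      ≤⟨ *-monoˡ-≤ N pairs ⟩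
    N * (N * 2 ^ N) * N
      ≡⟨ solve 2 (λ n x → n :* (n :* x) :* n := x :* (n :* (n :* (n :* con 1)))) refl N (2 ^ N) ⟩
    2 ^ N * N ^ 3
      ≤⟨ *-monoʳ-≤ (2 ^ N) (^-monoˡ-≤ 3 (<⇒≤ (n<2^1+log N))) ⟩
    2 ^ N * (2 ^ suc L) ^ 3
      ≡⟨ cong (2 ^ N *_) (^-*-assoc 2 (suc L) 3) ⟩
    2 ^ N * 2 ^ suc m ∎)
    where
    open ≤-Reasoning
    count : Fin N → Fin N → Subset N → ℕ
    count p q F = ⟦ Difference.first s p q (suc m) F ⟧
    pairs : ∑ (subsets N) late * 2 ^ suc m ≤ N * (N * 2 ^ N)
    pairs = begin
      ∑ (subsets N) late * 2 ^ suc m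
        ≡⟨ cong (_* 2 ^ suc m) (trans (∑-swap (subsets N) (allFin N) _)
             (∑-cong (allFin N) λ p → ∑-swap (subsets N) (allFin N) (λ F q → count p q F))) ⟩
      ∑ (allFin N) (λ p → ∑ (allFin N) λ q → ∑ (subsets N) (count p q)) * 2 ^ suc m
        ≡⟨ trans (∑-*ʳ (allFin N) (λ p → ∑ (allFin N) λ q → ∑ (subsets N) (count p q)) (2 ^ suc m))
             (∑-cong (allFin N) λ p → ∑-*ʳ (allFin N) (λ q → ∑ (subsets N) (count p q)) (2 ^ suc m)) ⟩
      ∑ (allFin N) (λ p → ∑ (allFin N) λ q → ∑ (subsets N) (count p q) * 2 ^ suc m)
        ≤⟨ ∑-allFin _ _ (λ p → ∑-allFin _ _ λ q → Difference.count-first s p q (suc m)) ⟩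
      N * (N * 2 ^ N) ∎

  ∑-rounds : ∑ (subsets N) rounds ≤ 2 ^ N * suc m
  ∑-rounds = begin
    ∑ (subsets N) rounds                                   ≤⟨ ∑-mono (subsets N) rounds-≤-late ⟩
    ∑ (subsets N) (λ F → m + late F * N)                   ≡⟨ ∑-+ (subsets N) (λ _ → m) _ ⟩
    ∑ (subsets N) (λ _ → m) + ∑ (subsets N) (λ F → late F * N)
      ≡⟨ cong₂ _+_ (trans (∑-const (subsets N) m) (cong (_* m) (length-subsets N))) (sym (∑-*ʳ (subsets N) late N)) ⟩
    2 ^ N * m + ∑ (subsets N) late * N                     ≤⟨ +-monoʳ-≤ (2 ^ N * m) ∑-late ⟩
    2 ^ N * m + 2 ^ N                                      ≡⟨ trans (+-comm _ (2 ^ N)) (sym (*-suc (2 ^ N) m)) ⟩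
    2 ^ N * suc m                                          ∎
    where open ≤-Reasoning

  ∑-time-upper : 1 ≤ L → ∑ (subsets N) time ≤ 973 * (N * L) * 2 ^ N
  ∑-time-upper 1≤L = begin
    ∑ (subsets N) time                                 ≤⟨ ∑-mono (subsets N) (λ F → Run.upper (runs F)) ⟩
    ∑ (subsets N) (λ F → 139 * N * suc (rounds F))     ≡⟨ sym (∑-*ˡ (subsets N) (suc ∘ rounds) (139 * N)) ⟩
    139 * N * ∑ (subsets N) (suc ∘ rounds)             ≡⟨ cong (139 * N *_) (∑-+ (subsets N) (λ _ → 1) rounds) ⟩
    139 * N * (∑ (subsets N) (λ _ → 1) + ∑ (subsets N) rounds)
      ≤⟨ *-monoʳ-≤ (139 * N) (+-mono-≤ (≤-reflexive (trans (∑-const (subsets N) 1)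
           (trans (*-identityʳ _) (length-subsets N)))) ∑-rounds) ⟩
    139 * N * (2 ^ N + 2 ^ N * (3 + L * 3))
      ≡⟨ solve 3 (λ n x l → con 139 :* n :* (x :+ x :* (con 3 :+ l :* con 3)) := con 139 :* n :* (x :* (con 4 :* con 1 :+ l :* con 3))) refl N (2 ^ N) L ⟩
    139 * N * (2 ^ N * (4 * 1 + L * 3))
      -- Since `L ≥ 1`, the constant 4 is at most `4 * L`; this leads to 973 = 139 * 7.
      ≤⟨ *-monoʳ-≤ (139 * N) (*-monoʳ-≤ (2 ^ N) (+-monoˡ-≤ (L * 3) (*-monoʳ-≤ 4 1≤L))) ⟩
    139 * N * (2 ^ N * (4 * L + L * 3))
      ≡⟨ solve 3 (λ n x l → con 139 :* n :* (x :* (con 4 :* l :+ l :* con 3)) := con 973 :* (n :* l) :* x) refl N (2 ^ N) L ⟩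
    973 * (N * L) * 2 ^ N ∎
    where open ≤-Reasoning

-- Lower bound for a fixed last transition

module _ {n : ℕ} (j : Fin n) (F : Subset (suc n)) where

  private
    t : Fin (suc n)
    t = suc j
    N = suc n
    s = next t

    x : ℕ → Bool
    x i = lookup F (orbit s i zero)

  -- `inject₁ j` and `fromℕ n` are the two predecessors of `t`, one on the tail and one on the
  -- cycle.
  last-differs : Set
  last-differs = lookup F (inject₁ j) xor lookup F (fromℕ n) ≡ true

  x-j : x (toℕ j) ≡ lookup F (inject₁ j)
  x-j = cong (lookup F) (trans (cong (λ i → orbit s i zero) (sym (toℕ-inject₁ j))) (orbit-state t (inject₁ j)))

  x-n : x n ≡ lookup F (fromℕ n)
  x-n = cong (lookup F) (trans (cong (λ i → orbit s i zero) (sym (toℕ-fromℕ n))) (orbit-state t (fromℕ n)))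

  -- If the states p < q before the cycle were equivalent, then the sequence x would
  -- have period q - p from p on. The cycle gives it the period c = n - j from suc j
  -- on, so that x j and x n = x (j + c) would both be x (j + c * (q - p)).
  separated : last-differs → ∀ p d → p + suc d ≤ toℕ j → ¬ (∀ i → x (p + i) ≡ x (p + suc d + i))
  separated differ p d q≤j same = contradiction (trans (sym differ) (trans (cong₂ _xor_ (sym x-j) (sym x-n))
    (trans (cong (_xor x n) equal) (Boolₚ.xor-same (x n))))) λ ()
    where
    c = n ∸ toℕ j
    j+c≡n : toℕ j + c ≡ n
    j+c≡n = m+[n∸m]≡n (<⇒≤ (toℕ<n j))

    period : ∀ i → p ≤ i → x i ≡ x (i + suc d)
    period i p≤i = begin
      x i                     ≡⟨ cong x (sym (m+[n∸m]≡n p≤i)) ⟩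
      x (p + (i ∸ p))         ≡⟨ same (i ∸ p) ⟩
      x (p + suc d + (i ∸ p)) ≡⟨ cong x (solve 3 (λ p d i → p :+ d :+ i := p :+ i :+ d) refl p (suc d) (i ∸ p)) ⟩
      x (p + (i ∸ p) + suc d) ≡⟨ cong (λ i → x (i + suc d)) (m+[n∸m]≡n p≤i) ⟩
      x (i + suc d)           ∎
      where open ≡-Reasoning

    cycle : ∀ i → suc (toℕ j) ≤ i → x i ≡ x (i + c)
    cycle i j<i = cong (lookup F) (begin
      orbit s i zero                               ≡⟨ cong (λ i → orbit s i zero) (sym (m+[n∸m]≡n j<i)) ⟩
      orbit s (toℕ t + r) zero                     ≡⟨ sym (orbit-+ s (toℕ t) r zero) ⟩
      orbit s r (orbit s (toℕ t) zero)             ≡⟨ cong (orbit s r) (trans (orbit-state t t) (sym (orbit-N t))) ⟩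
      orbit s r (orbit s N zero)                   ≡⟨ orbit-+ s N r zero ⟩
      orbit s (N + r) zero                         ≡⟨ cong (λ i → orbit s (suc i + r) zero) (sym j+c≡n) ⟩
      orbit s (suc (toℕ j + c) + r) zero           ≡⟨ cong (λ i → orbit s i zero)
                                                        (solve 3 (λ j c r → con 1 :+ (j :+ c) :+ r := con 1 :+ j :+ r :+ c) refl (toℕ j) c r) ⟩
      orbit s (toℕ t + r + c) zero                 ≡⟨ cong (λ i → orbit s (i + c) zero) (m+[n∸m]≡n j<i) ⟩
      orbit s (i + c) zero                         ∎)
      where
      open ≡-Reasoning
      r = i ∸ toℕ t

    equal : x (toℕ j) ≡ x n
    equal = begin
      x (toℕ j)                 ≡⟨ period-multiple x p (suc d) period c (toℕ j) (≤-trans (m≤m+n p (suc d)) q≤j) ⟩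
      x (toℕ j + c * suc d)     ≡⟨ cong (λ i → x (toℕ j + i)) (*-comm c (suc d)) ⟩
      x (toℕ j + (c + d * c))   ≡⟨ cong x (sym (+-assoc (toℕ j) c (d * c))) ⟩
      x (toℕ j + c + d * c)     ≡⟨ cong (λ i → x (i + d * c)) j+c≡n ⟩
      x (n + d * c)             ≡⟨ sym (period-multiple x (suc (toℕ j)) c cycle d n (toℕ<n j)) ⟩
      x n                       ∎
      where open ≡-Reasoning

  -- Two tail states with the same word of length `suc ρ` would agree forever by `stable`,
  -- contradicting `separated`. So the words embed the tail into `Fin (2 ^ suc ρ)`.
  tail-≤ : last-differs → toℕ t ≤ 2 ^ suc (rounds t F)
  tail-≤ differ = injective⇒≤ {f = λ i → encode (suc ρ) (λ k → x (toℕ i + k))} λ {i} {i′} eq → injective i i′ eq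
    where
    ρ = rounds t F
    ordered : ∀ p q → p < q → q < toℕ t → encode (suc ρ) (λ k → x (p + k)) ≢ encode (suc ρ) (λ k → x (q + k))
    ordered p q p<q (s≤s q≤j) eq with m≤n⇒∃[o]m+o≡n p<q
    ... | d , refl = separated differ p d (subst (_≤ toℕ j) (sym (+-suc p d)) q≤j)
      (λ i → subst (λ q → x (p + i) ≡ x (q + i)) (sym (+-suc p d)) (forever i))
      where
      P = orbit s p zero
      Q = orbit s (suc p + d) zero
      along : ∀ r k → lookup F (orbit s k (orbit s r zero)) ≡ x (r + k)
      along r k = cong (lookup F) (orbit-+ s r k zero)
      agree : ∀ k → k < suc ρ → separates s P Q F k ≡ false
      agree k k< = trans (cong₂ _xor_ (along p k) (along (suc p + d) k))
        (trans (cong (_xor x (suc p + d + k)) (encode-injective (suc ρ) (λ k → x (p + k)) (λ k → x (suc p + d + k)) eq k k<)) (Boolₚ.xor-same (x (suc p + d + k))))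
      forever : ∀ i → x (p + i) ≡ x (suc p + d + i)
      forever i = trans (sym (along p i)) (trans (xor-false⇒≡ (Run.stable (runs t F) P Q agree i)) (along (suc p + d) i))
    injective : ∀ (i i′ : Fin (toℕ t)) → encode (suc ρ) (λ k → x (toℕ i + k)) ≡ encode (suc ρ) (λ k → x (toℕ i′ + k)) → i ≡ i′
    injective i i′ eq with <-cmp (toℕ i) (toℕ i′)
    ... | tri< lt _ _ = contradiction eq (ordered _ _ lt (toℕ<n i′))
    ... | tri≈ _ e _  = toℕ-injective e
    ... | tri> _ _ gt = contradiction (sym eq) (ordered _ _ gt (toℕ<n i))

  time-lower : ⌈ N /2⌉ ≤ toℕ t → last-differs → N * ⌊log₂ N ⌋ ≤ time t F
  time-lower half differ = ≤-trans (*-monoʳ-≤ N (≤-trans (n≤2^k⇒log≤k N (2 + ρ) (begin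
    N                          ≡⟨ sym (⌊n/2⌋+⌈n/2⌉≡n N) ⟩
    ⌊ N /2⌋ + ⌈ N /2⌉          ≤⟨ +-mono-≤ (≤-trans (⌊n/2⌋≤⌈n/2⌉ N) bound) bound ⟩
    2 ^ suc ρ + 2 ^ suc ρ      ≡⟨ cong (2 ^ suc ρ +_) (sym (+-identityʳ _)) ⟩
    2 ^ (2 + ρ)                ∎)) (≤-trans (n≤1+n (2 + ρ)) (≤-reflexive (+-comm 3 ρ))))) (Run.lower (runs t F))
    where
    open ≤-Reasoning
    ρ = rounds t F
    bound = ≤-trans half (tail-≤ differ)

-- By `count-differ`, exactly half of all sets separate the two predecessors of `t`, and each of
-- these forces a long run; the factor 2 clears this half.
∑-time-lower : ∀ (t : Fin (suc n)) →
               ⟦ ⌈ suc n /2⌉ ≤ᵇ toℕ t ⟧ * (suc n * ⌊log₂ suc n ⌋ * 2 ^ suc n) ≤ ∑ (subsets (suc n)) (time t) * 2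
-- The indicator vanishes here, because half of `suc n`, rounded up, is at least 1.
∑-time-lower zero = z≤n
∑-time-lower {n} (suc j) with ⌈ suc n /2⌉ ≤? suc (toℕ j)
... | no ¬half rewrite dec-false (⌈ suc n /2⌉ ≤? suc (toℕ j)) ¬half = z≤n
... | yes half = ≤-trans (*-monoˡ-≤ M (indicator≤1 (⌈ suc n /2⌉ ≤ᵇ suc (toℕ j)))) (begin
  1 * M                                                       ≡⟨ *-identityˡ M ⟩
  NL * 2 ^ suc n                                              ≡⟨ cong (NL *_) (sym (count-differ {a = inject₁ j} {fromℕ n} (λ eq → fromℕ≢inject₁ (sym eq)))) ⟩
  NL * (∑ (subsets (suc n)) differs * 2)                      ≡⟨ sym (*-assoc NL _ 2) ⟩
  NL * ∑ (subsets (suc n)) differs * 2                        ≡⟨ cong (_* 2) (∑-*ˡ (subsets (suc n)) differs NL) ⟩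
  ∑ (subsets (suc n)) (λ F → NL * differs F) * 2              ≤⟨ *-monoˡ-≤ 2 (∑-mono (subsets (suc n)) bound) ⟩
  ∑ (subsets (suc n)) (time (suc j)) * 2                      ∎)
  where
  open ≤-Reasoning
  NL = suc n * ⌊log₂ suc n ⌋
  M = NL * 2 ^ suc n
  differs : Subset (suc n) → ℕ
  differs F = ⟦ lookup F (inject₁ j) xor lookup F (fromℕ n) ⟧
  indicator≤1 : ∀ b → ⟦ b ⟧ ≤ 1
  indicator≤1 true  = ≤-refl
  indicator≤1 false = z≤n
  bound : ∀ F → NL * differs F ≤ time (suc j) F
  bound F with lookup F (inject₁ j) xor lookup F (fromℕ n) in eq
  ... | true  = ≤-trans (≤-reflexive (*-identityʳ NL)) (time-lower j F half eq)
  ... | false = ≤-trans (≤-reflexive (*-zeroʳ NL)) z≤n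

-- Averaging over all unary automata

count-≥ : ∀ n m → n ≤ ∑ (allFin n) (λ t → ⟦ m ≤ᵇ toℕ t ⟧) + m
count-≥ zero    m       = z≤n
count-≥ (suc n) zero    = ≤-trans (s≤s (count-≥ n zero)) (≤-reflexive (cong (λ k → suc (k + 0))
  (cong sum (trans (map-tabulate {n = n} (λ i → i) _) (sym (map-tabulate {n = n} suc _))))))
count-≥ (suc n) (suc m) = ≤-trans (s≤s (count-≥ n m)) (≤-reflexive (trans (sym (+-suc _ m)) (cong (_+ suc m)
  (cong sum (trans (map-tabulate {n = n} (λ i → i) _) (trans (shifted m) (sym (map-tabulate {n = n} suc _))))))))
  where
  shifted : ∀ m → tabulate {n = n} (λ i → ⟦ m ≤ᵇ toℕ i ⟧) ≡ tabulate {n = n} (λ i → ⟦ suc m ≤ᵇ suc (toℕ i) ⟧)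
  shifted zero    = refl
  shifted (suc m) = refl

W : ∀ n → Automaton 1 n → ℕ
W n A = Run.time (run A)

total : ℕ → ℕ
total n = ∑ (unaryAutomata n) (W n)

length-unaryAutomata : ∀ n → length (unaryAutomata (suc n)) ≡ suc n * 2 ^ suc n
length-unaryAutomata n = begin
  length (unaryAutomata (suc n))                              ≡⟨ sym (trans (∑-const (unaryAutomata (suc n)) 1) (*-identityʳ _)) ⟩
  ∑ (unaryAutomata (suc n)) (λ _ → 1)                         ≡⟨ ∑-cartesianProductWith unary (allFin (suc n)) (subsets (suc n)) _ ⟩
  ∑ (allFin (suc n)) (λ _ → ∑ (subsets (suc n)) (λ _ → 1))    ≡⟨ ∑-const (allFin (suc n)) _ ⟩
  length (allFin (suc n)) * ∑ (subsets (suc n)) (λ _ → 1)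
    ≡⟨ cong₂ _*_ (length-tabulate {n = suc n} (λ i → i)) (trans (∑-const (subsets (suc n)) 1) (trans (*-identityʳ _) (length-subsets (suc n)))) ⟩
  suc n * 2 ^ suc n ∎
  where open ≡-Reasoning

total-unary : ∀ n → total (suc n) ≡ ∑ (allFin (suc n)) (λ t → ∑ (subsets (suc n)) (time t))
total-unary n = ∑-cartesianProductWith unary (allFin (suc n)) (subsets (suc n)) (W (suc n))

total-upper : ∀ n → 1 ≤ ⌊log₂ suc n ⌋ → total (suc n) ≤ 973 * (suc n * ⌊log₂ suc n ⌋) * (suc n * 2 ^ suc n)
total-upper n 1≤L = begin
  total (suc n)                                              ≡⟨ total-unary n ⟩
  ∑ (allFin (suc n)) (λ t → ∑ (subsets (suc n)) (time t))    ≤⟨ ∑-mono (allFin (suc n)) (λ t → ∑-time-upper t 1≤L) ⟩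
  ∑ (allFin (suc n)) (λ _ → B * 2 ^ suc n)                   ≡⟨ ∑-const (allFin (suc n)) (B * 2 ^ suc n) ⟩
  length (allFin (suc n)) * (B * 2 ^ suc n)                  ≡⟨ cong (_* (B * 2 ^ suc n)) (length-tabulate {n = suc n} (λ i → i)) ⟩
  suc n * (B * 2 ^ suc n)                                    ≡⟨ solve 3 (λ n b x → n :* (b :* x) := b :* (n :* x)) refl (suc n) B (2 ^ suc n) ⟩
  B * (suc n * 2 ^ suc n)                                    ∎
  where
  open ≤-Reasoning
  B = 973 * (suc n * ⌊log₂ suc n ⌋)

n≤4*⌊n/2⌋ : ∀ n → 2 ≤ n → n ≤ ⌊ n /2⌋ * 4
n≤4*⌊n/2⌋ n 2≤n = begin
  n                          ≡⟨ sym (⌊n/2⌋+⌈n/2⌉≡n n) ⟩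
  h + ⌈ n /2⌉                ≤⟨ +-monoʳ-≤ h (⌊n/2⌋-mono (n≤1+n (suc n))) ⟩
  h + (1 + h)                ≤⟨ +-monoʳ-≤ h (+-monoˡ-≤ h (⌊n/2⌋-mono 2≤n)) ⟩
  h + (h + h)                ≤⟨ m≤m+n _ h ⟩
  h + (h + h) + h            ≡⟨ solve 1 (λ h → h :+ (h :+ h) :+ h := h :* con 4) refl h ⟩
  h * 4                      ∎
  where
  open ≤-Reasoning
  h = ⌊ n /2⌋

upper-half : ∀ n → ⌊ n /2⌋ ≤ ∑ (allFin n) (λ t → ⟦ ⌈ n /2⌉ ≤ᵇ toℕ t ⟧)
upper-half n = +-cancelʳ-≤ ⌈ n /2⌉ _ _ (≤-trans (≤-reflexive (⌊n/2⌋+⌈n/2⌉≡n n)) (count-≥ n ⌈ n /2⌉))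

-- The factor 8 is 4 * 2: at least a quarter of the transitions lie in the upper half, and for each
-- of them half of the sets count.
total-lower : ∀ n → 2 ≤ suc n → suc n * ⌊log₂ suc n ⌋ * (suc n * 2 ^ suc n) ≤ total (suc n) * 8
total-lower n 2≤N = begin
  NL * (N * P)                              ≡⟨ solve 3 (λ l n p → l :* (n :* p) := n :* (l :* p)) refl NL N P ⟩
  N * (NL * P)                              ≤⟨ *-monoˡ-≤ (NL * P) (≤-trans (n≤4*⌊n/2⌋ N 2≤N) (*-monoˡ-≤ 4 (upper-half N))) ⟩
  c * 4 * (NL * P)                          ≡⟨ solve 2 (λ c x → c :* con 4 :* x := c :* x :* con 4) refl c (NL * P) ⟩
  c * (NL * P) * 4                          ≡⟨ cong (_* 4) (∑-*ʳ (allFin N) half (NL * P)) ⟩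
  ∑ (allFin N) (λ t → half t * (NL * P)) * 4
    ≤⟨ *-monoˡ-≤ 4 (∑-mono (allFin N) ∑-time-lower) ⟩
  ∑ (allFin N) (λ t → ∑ (subsets N) (time t) * 2) * 4
    ≡⟨ cong (_* 4) (sym (∑-*ʳ (allFin N) (λ t → ∑ (subsets N) (time t)) 2)) ⟩
  ∑ (allFin N) (λ t → ∑ (subsets N) (time t)) * 2 * 4
    ≡⟨ *-assoc (∑ (allFin N) (λ t → ∑ (subsets N) (time t))) 2 4 ⟩
  ∑ (allFin N) (λ t → ∑ (subsets N) (time t)) * 8
    ≡⟨ cong (_* 8) (sym (total-unary n)) ⟩
  total N * 8                               ∎
  where
  open ≤-Reasoning
  N = suc n
  NL = N * ⌊log₂ N ⌋
  P = 2 ^ N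
  half : Fin N → ℕ
  half t = ⟦ ⌈ N /2⌉ ≤ᵇ toℕ t ⟧
  c = ∑ (allFin N) half

-- Passage to rational averages

/-mono : ∀ a b c d .{{_ : NonZero b}} .{{_ : NonZero d}} → a * d ≤ c * b → ℤ.+ a / b ℚ.≤ ℤ.+ c / d
/-mono a (suc b) c (suc d) le = *≤* (subst₂ ℤ._≤_ (ℤₚ.pos-* a (suc d)) (ℤₚ.pos-* c (suc b)) (ℤ.+≤+ le))

/-*-/1 : ∀ a b c .{{_ : NonZero b}} → (ℤ.+ a / b) ℚ.* (ℤ.+ c / 1) ≡ ℤ.+ (a * c) / b
/-*-/1 a (suc b) c = cong₂ mkℚᵘ (sym (ℤₚ.pos-* a c)) (*-identityʳ b)

average-/ : ∀ xs d .{{_ : NonZero d}} → length xs ≡ d → average xs ≡ ℤ.+ sum xs / d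
average-/ (_ ∷ _) _ refl = refl

theorem4p4 : Σ[ W ∈ (∀ n → Automaton 1 n → ℕ) ]
    (∀ n (A : Automaton 1 n) → A ∈ unaryAutomata n → RunningTime A (W n A))
    × (λ n → average (map (W n) (unaryAutomata n))) =Θ nlogn
theorem4p4 = W , (λ n A _ → Run.runningTime (run A)) , ℤ.+ 1 / 8 , ℤ.+ 973 / 1 , 2 ,
  *<* (ℤ.+<+ (s≤s z≤n)) , *<* (ℤ.+<+ (s≤s z≤n)) , bounds
  where
  -- From `n = 2` on the logarithm is at least 1, as the upper bound requires, and at least a
  -- quarter of the states lie in the upper half.
  bounds : ∀ n → 2 ≤ n → (ℤ.+ 1 / 8) ℚ.* nlogn n ℚ.≤ average (map (W n) (unaryAutomata n)) ×
                         average (map (W n) (unaryAutomata n)) ℚ.≤ (ℤ.+ 973 / 1) ℚ.* nlogn n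
  bounds (suc n) 2≤N = subst₂ ℚ._≤_ (sym (/-*-/1 1 8 NL)) (sym average-total)
        (/-mono (1 * NL) 8 (total N) (N * 2 ^ N) (subst (λ k → k * (N * 2 ^ N) ≤ total N * 8) (sym (*-identityˡ NL)) (total-lower n 2≤N)))
    , subst₂ ℚ._≤_ (sym average-total) (sym (/-*-/1 973 1 NL))
        (/-mono (total N) (N * 2 ^ N) (973 * NL) 1
          (≤-trans (≤-reflexive (*-identityʳ _)) (total-upper n (⌊log₂⌋-mono-≤ {2} 2≤N))))
    where
    N = suc n
    NL = N * ⌊log₂ N ⌋
    instance
      nonZero : NonZero (N * 2 ^ N)
      nonZero = m*n≢0 N (2 ^ N) {{_}} {{m^n≢0 2 N}}
    average-total : average (map (W N) (unaryAutomata N)) ≡ ℤ.+ total N / (N * 2 ^ N)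
    average-total = average-/ (map (W N) (unaryAutomata N)) (N * 2 ^ N)
      (trans (length-map (W N) (unaryAutomata N)) (length-unaryAutomata n))
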